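{- Let $p$ be a prime. Up to affine transformations (elements of $AGL(2,p)$) there is a unique set $S\subseteq\mathbb{F}_p^2$ of size $\frac{p(p-1)}{2}$ which is equidistributed in exactly $p-2$ directions; that is, such a set exists, and any two such sets are images of each other under an element of $AGL(2,p)$. Moreover, every subset of $\mathbb{F}_p^2$ having exactly $3$ special directions can be transformed by an element of $AGL(2,p)$ to either $S$ or $S^c$, where $S^c=\mathbb{F}_p^2\setminus S$ is the complement of $S$.
   Context: $\mathbb{F}_p$ is the field with $p$ elements. A direction is an equivalence class of nonzero vectors of $\mathbb{F}_p^2$ under multiplication by nonzero scalars; there are $p+1$ directions, and each corresponds to a class of $p$ parallel affine lines. A set $S\subseteq\mathbb{F}_p^2$ is equidistributed in a direction if all $p$ lines parallel to that direction intersect $S$ in the same number of points. A direction is called special for $S$ if $S$ is not equidistributed in it. $AGL(2,p)$ is the group of invertible affine transformations of $\mathbb{F}_p^2$. -}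

module Defs where

open import Data.Fin using (Fin; toℕ)
open import Data.Fin.Properties using (any?) renaming (_≟_ to _≟ᶠ_)
open import Data.List using (List; allFin; cartesianProduct; filter; length)
import Data.Nat as ℕ
open import Data.Nat using (ℕ; NonZero)
open import Data.Nat.DivMod using (_mod_)
open import Data.Product using (Σ; ∃; _×_; _,_; proj₁)
open import Data.Product.Properties using (≡-dec)
open import Function.Bundles using (_⇔_)
open import Function.Definitions using (Bijective)
open import Level using (0ℓ)
open import Relation.Binary.Definitions using (DecidableEquality)
open import Relation.Binary.PropositionalEquality using (_≡_; _≢_)
open import Relation.Nullary using (¬_)
open import Relation.Unary using (Pred; Decidable; ∁) renaming (_∩_ to _∩ᴾ_)
open import Relation.Unary.Properties using (∁?; _∩?_)

-- The affine plane over ℤ/p, which is the field 𝔽_p when p is prime.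
module AffinePlane (p : ℕ) .{{_ : NonZero p}} where

  infixl 6 _+_ _⊕_
  infixl 7 _*_
  infixr 7 _·_ _∩_
  infix  8 _ᶜ
  infix  4 _∈_ _∼_ _≟_

  𝔽 : Set
  𝔽 = Fin p

  0# : 𝔽
  0# = 0 mod p

  _+_ : 𝔽 → 𝔽 → 𝔽
  a + b = (toℕ a ℕ.+ toℕ b) mod p

  _*_ : 𝔽 → 𝔽 → 𝔽
  a * b = (toℕ a ℕ.* toℕ b) mod p

  𝔽² : Set
  𝔽² = 𝔽 × 𝔽

  𝟎 : 𝔽²
  𝟎 = 0# , 0#

  _⊕_ : 𝔽² → 𝔽² → 𝔽²
  (a , b) ⊕ (c , d) = a + c , b + d

  _·_ : 𝔽 → 𝔽² → 𝔽²
  t · (a , b) = t * a , t * b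

  _≟_ : DecidableEquality 𝔽²
  _≟_ = ≡-dec _≟ᶠ_ _≟ᶠ_

  points : List 𝔽²
  points = cartesianProduct (allFin p) (allFin p)

  -- Membership is required to be decidable so that subsets can be counted.
  record Subset : Set₁ where
    field
      mem  : Pred 𝔽² 0ℓ
      mem? : Decidable mem

  open Subset public

  _∈_ : 𝔽² → Subset → Set
  x ∈ S = mem S x

  size : Subset → ℕ
  size S = length (filter (mem? S) points)

  _ᶜ : Subset → Subset
  S ᶜ = record { mem = ∁ (mem S) ; mem? = ∁? (mem? S) }

  _∩_ : Subset → Subset → Subset
  S ∩ T = record { mem = mem S ∩ᴾ mem T ; mem? = mem? S ∩? mem? T }

  -- Directions are represented by nonzero vectors; two of them are the same
  -- direction when they are related by _∼_.
  Direction : Set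
  Direction = Σ 𝔽² (_≢ 𝟎)

  _∼_ : Direction → Direction → Set
  (v , _) ∼ (w , _) = ∃ λ c → c ≢ 0# × w ≡ c · v

  line : 𝔽² → Direction → Subset
  line x (v , _) = record
    { mem  = λ y → ∃ λ t → y ≡ x ⊕ t · v
    ; mem? = λ y → any? (λ t → y ≟ x ⊕ t · v)
    }

  -- The lines parallel to d are the lines with direction d through the
  -- various points of the plane.
  Equidistributed : Subset → Direction → Set
  Equidistributed S d = ∀ x y → size (S ∩ line x d) ≡ size (S ∩ line y d)

  Special : Subset → Direction → Set
  Special S d = ¬ Equidistributed S d

  -- Exactly k directions, counted up to _∼_, satisfy P.
  Exactly : ℕ → Pred Direction 0ℓ → Set
  Exactly k P = Σ (Fin k → Σ Direction P) (Bijective _≡_ (λ d e → proj₁ d ∼ proj₁ e))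

  -- (x , y) ↦ (a x + b y + e , c x + d y + f)
  record AffineMap : Set where
    constructor affine
    field
      a b c d e f : 𝔽

  apply : AffineMap → 𝔽² → 𝔽²
  apply (affine a b c d e f) (x , y) = a * x + b * y + e , c * x + d * y + f

  record AGL : Set where
    field
      to from : AffineMap
      to∘from : ∀ x → apply to (apply from x) ≡ x
      from∘to : ∀ x → apply from (apply to x) ≡ x

  -- g transforms S to T, that is, T is the image of S under g.
  _maps_onto_ : AGL → Subset → Subset → Set
  g maps S onto T = ∀ y → y ∈ T ⇔ (∃ λ x → x ∈ S × apply (AGL.to g) x ≡ y)

  _TransformsTo_ : Subset → Subset → Set
  S TransformsTo T = ∃ λ g → g maps S onto T

module Submission where

-- The p + 1 lines through a point q cover q with multiplicity p + 1 and every
-- other point once.  If all directions except those of (0 , 1), (1 , 0) and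
-- (1 , -1) are equidistributed for a set with indicator χ, then
-- p χ(x , y) = A(x) + B(y) + C(x + y) + const, where A, B and C count the points
-- of the set on the lines in these three directions.  Modulo p the sum
-- A + B + C is constant, so A, B and C are affine functions modulo p, with
-- slopes α, α and -α.  Their values lie in [0 , p], so if α vanished, there
-- would be an empty column and a full row.  Hence α is a unit, and A is 0 or p
-- at the root of its affine function; passing to the complement we may assume 0.
-- Then the values of A, B and C are the least residues of the affine functions,
-- and in the coordinates X = αx + β, Y = αy + γ the set consists of the points
-- for which the least residues of X and Y add up to at least p.  Any three
-- directions can be moved to the given ones by a linear map.

open import Defs
open import Algebra.Bundles using (CommutativeRing; RawRing)
import Algebra.Solver.Ring
open import Algebra.Solver.Ring.AlmostCommutativeRing using (_-Raw-AlmostCommutative⟶_; fromCommutativeRing)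
import Algebra.Solver.Ring.NaturalCoefficients.Default
open import Data.Bool using (if_then_else_)
open import Data.Fin using (Fin; suc; toℕ; zero)
open import Data.Fin.Permutation using (permutation)
open import Data.Fin.Properties
  using (all?; any?; suc-injective; toℕ-fromℕ<; toℕ-injective; toℕ<n; ∀-cons) renaming (_≟_ to _≟ᶠ_)
open import Data.List
  using (List; []; _++_; _∷_; allFin; cartesianProduct; filter; length; lookup; map; tabulate)
import Data.List.Membership.Propositional as Mem
open import Data.List.Membership.Propositional.Properties
  using (∈-allFin; ∈-cartesianProduct⁺; ∈-filter⁺; ∈-filter⁻; ∈-lookup; ∈-map∘filter⁺; ∈-map∘filter⁻)
open import Data.List.Membership.Propositional.Properties.WithK using (unique∧set⇒bag)
open import Data.List.Properties
  using (filter-++; filter-all; length-++; length-map; length-tabulate; map-tabulate)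
open import Data.List.Relation.Binary.BagAndSetEquality using (∼bag⇒↭)
open import Data.List.Relation.Binary.Permutation.Propositional.Properties using (↭-length)
import Data.List.Relation.Unary.All as All
open import Data.List.Relation.Unary.AllPairs using (_∷_)
open import Data.List.Relation.Unary.Any using (index)
open import Data.List.Relation.Unary.Any.Properties using (lookup-index)
open import Data.List.Relation.Unary.Unique.Propositional using (Unique)
import Data.List.Relation.Unary.Unique.Propositional.Properties as Uniqueₚ
open import Data.Maybe using (Maybe; just; nothing)
open import Data.Nat using (NonZero; _%_; _/_; _∸_; suc; zero; ℕ)
import Data.Nat as ℕ
open import Data.Nat.Coprimality using (coprime-Bézout; prime⇒coprime)
open import Data.Nat.DivMod using (%-distribˡ-*; %-distribˡ-+; _mod_; m%n<n; m*n/n≡m; m<n⇒m%n≡m; n%n≡0)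
open import Data.Nat.GCD using (module Bézout)
open import Data.Nat.Primality using (Prime; prime⇒nonTrivial; prime⇒nonZero)
import Data.Nat.Properties as ℕₚ
open import Data.Nat.Solver using (module +-*-Solver)
open import Data.Product using (_,_; _×_; proj₁; proj₂; ∃)
open import Data.Sum using (_⊎_; inj₁; inj₂)
import Data.Sum as Sum
open import Data.Unit using (tt)
open import Function using (Equivalence; _⇔_; _∘_; id; mk⇔)
open import Level using (0ℓ)
open import Relation.Binary.PropositionalEquality
open import Relation.Nullary using (Dec; contradiction; decidable-stable; does; no; yes; ¬?; ¬_)
open import Relation.Nullary.Decidable using (map′)
open import Relation.Unary using (Decidable; Pred; U)
open import Relation.Unary.Properties using (U?)

open import Algebra.Properties.Semiring.Sum ℕₚ.+-*-semiring
  using (sum; sum-syntax; sum-cong-≗; ∑-comm; ∑-distrib-+; ∑-permute; *-distribˡ-sum)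

-- Finite counts and sums

-- On [0 , p] congruence modulo p confuses only 0 with p, and incidence settles which of the two
-- occurs: an empty line meets every line of another direction, so none of those is full. An empty
-- column thus makes all row and diagonal counts least residues; the row at the root of B is then
-- empty, which does the same for the columns. The constant in the formula for p χ is found from a
-- column with p - 1 points: the formula becomes p χ = A + B + C - (p - 1), and 0 <= C <= p - 1 lets
-- A + B >= p alone decide membership. Conversely, χ of the model set is the carry of an addition,
-- so p χ(x , y) is the sum of two least residues minus the residue of the sum. Along a line each of
-- these three residues is constant or runs through all of 𝔽, which gives every line count. For
-- uniqueness, p + 1 - (p - 2) = 3 reduces the first claim to the second, and the sizes p(p - 1)/2
-- and p(p + 1)/2 separate the set from its complement. Identities between counts stay in ℕ, so
-- differences are written crosswise, with terms of either point on both sides.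

module Counting where

  open import Data.Nat using (_+_; _*_; _≤_; z≤n; s≤s)

  module _ {ℓ ℓ′ q q′} {A : Set ℓ} {B : Set ℓ′} {P : Pred A q} {Q : Pred B q′}
           (P? : Decidable P) (Q? : Decidable Q) where

    -- The image under `f` of one filtered list and the other filtered list are duplicate-free with
    -- the same members, hence permutations of each other.
    length-filter-↣ : ∀ {xs ys} → Unique xs → Unique ys → (∀ a → a Mem.∈ xs) → (∀ b → b Mem.∈ ys) →
      (f : A → B) → (∀ {a a′} → f a ≡ f a′ → a ≡ a′) →
      (∀ a → P a → Q (f a)) → (∀ b → Q b → ∃ λ a → P a × f a ≡ b) →
      length (filter P? xs) ≡ length (filter Q? ys)
    length-filter-↣ {xs} {ys} xs! ys! ∈xs ∈ys f inj P⇒Q Q⇒P = begin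
      length (filter P? xs)            ≡⟨ length-map f (filter P? xs) ⟨
      length (map f (filter P? xs))    ≡⟨ ↭-length (∼bag⇒↭ (unique∧set⇒bag
                                            (Uniqueₚ.map⁺ inj (Uniqueₚ.filter⁺ P? xs!))
                                                (Uniqueₚ.filter⁺ Q? ys!) (mk⇔ to from))) ⟩
      length (filter Q? ys)            ∎
      where
      open ≡-Reasoning
      to : ∀ {b} → b Mem.∈ map f (filter P? xs) → b Mem.∈ filter Q? ys
      to {b} b∈ with ∈-map∘filter⁻ f P? {f = f} {xs = xs} b∈
      ... | a , _ , refl , Pa = ∈-filter⁺ Q? (∈ys (f a)) (P⇒Q a Pa)
      from : ∀ {b} → b Mem.∈ filter Q? ys → b Mem.∈ map f (filter P? xs)
      from {b} b∈ with Q⇒P b (proj₂ (∈-filter⁻ Q? {xs = ys} b∈))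
      ... | a , Pa , refl = ∈-map∘filter⁺ f P? {f = f} (a , ∈xs a , refl , Pa)

  lookup-injective : ∀ {ℓ} {A : Set ℓ} {xs : List A} → Unique xs → ∀ {i j} → lookup xs i ≡ lookup xs j → i ≡ j
  lookup-injective (_ ∷ _)    {zero}  {zero}  _ = refl
  lookup-injective (x≢ ∷ _)   {zero}  {suc j} e = contradiction e (All.lookup x≢ (∈-lookup j))
  lookup-injective (x≢ ∷ _)   {suc i} {zero}  e = contradiction (sym e) (All.lookup x≢ (∈-lookup i))
  lookup-injective (_ ∷ xs!)  {suc i} {suc j} e = cong suc (lookup-injective xs! e)

  -- `Q` is a separate predicate rather than the negation of `P`, so that specialness and
  -- equidistribution can take the two roles in either order.
  length-filter-complement : ∀ {ℓ q q′} {A : Set ℓ} {P : Pred A q} {Q : Pred A q′} (P? : Decidable P)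
      (Q? : Decidable Q) →
    (∀ {a} → P a → ¬ Q a) → (∀ {a} → ¬ P a → Q a) →
    ∀ xs → length (filter P? xs) + length (filter Q? xs) ≡ length xs
  length-filter-complement P? Q? P⇒¬Q ¬P⇒Q []       = refl
  length-filter-complement P? Q? P⇒¬Q ¬P⇒Q (x ∷ xs) with P? x | Q? x
  ... | yes Px | yes Qx = contradiction Qx (P⇒¬Q Px)
  ... | yes _  | no _   = cong suc (length-filter-complement P? Q? P⇒¬Q ¬P⇒Q xs)
  ... | no _   | yes _  = trans (ℕₚ.+-suc _ _) (cong suc (length-filter-complement P? Q? P⇒¬Q ¬P⇒Q xs))
  ... | no ¬Px | no ¬Qx = contradiction (¬P⇒Q ¬Px) ¬Qx

  𝟙 : ∀ {q} {P : Set q} → Dec P → ℕ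
  𝟙 P? = if does P? then 1 else 0

  𝟙-yes : ∀ {q} {P : Set q} (P? : Dec P) → P → 𝟙 P? ≡ 1
  𝟙-yes (yes _) _ = refl
  𝟙-yes (no ¬P) P = contradiction P ¬P

  𝟙-no : ∀ {q} {P : Set q} (P? : Dec P) → ¬ P → 𝟙 P? ≡ 0
  𝟙-no (yes P) ¬P = contradiction P ¬P
  𝟙-no (no _)  _  = refl

  𝟙≤1 : ∀ {q} {P : Set q} (P? : Dec P) → 𝟙 P? ≤ 1
  𝟙≤1 (yes _) = s≤s z≤n
  𝟙≤1 (no _)  = z≤n

  𝟙-complement : ∀ {q} {P : Set q} (P? : Dec P) → 𝟙 P? + 𝟙 (¬? P?) ≡ 1
  𝟙-complement (yes _) = refl
  𝟙-complement (no _)  = refl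

  length-filter-tabulate : ∀ {ℓ q n} {A : Set ℓ} {P : Pred A q} (P? : Decidable P) (f : Fin n → A) →
    length (filter P? (tabulate f)) ≡ ∑[ i < n ] 𝟙 (P? (f i))
  length-filter-tabulate {n = zero}  P? f = refl
  length-filter-tabulate {n = suc n} P? f with P? (f zero)
  ... | yes _ = cong suc (length-filter-tabulate P? (f ∘ suc))
  ... | no _  = length-filter-tabulate P? (f ∘ suc)

  length-filter-cartesianProduct : ∀ {ℓ ℓ′ q m n} {A : Set ℓ} {B : Set ℓ′} {P : Pred (A × B) q}
      (P? : Decidable P)
    (f : Fin m → A) (g : Fin n → B) →
    length (filter P? (cartesianProduct (tabulate f) (tabulate g))) ≡ ∑[ i < m ] ∑[ j < n ] 𝟙 (P? (f i , g j))
  length-filter-cartesianProduct {m = zero}  P? f g = refl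
  length-filter-cartesianProduct {m = suc m} {n} P? f g = begin
    length (filter P? (xs ++ ys))                      ≡⟨ cong length (filter-++ P? xs ys) ⟩
    length (filter P? xs ++ filter P? ys)              ≡⟨ length-++ (filter P? xs) ⟩
    length (filter P? xs) + length (filter P? ys)      ≡⟨ cong₂ _+_
      (trans (cong (length ∘ filter P?) (map-tabulate g (f zero ,_)))
          (length-filter-tabulate P? (λ j → f zero , g j)))
      (length-filter-cartesianProduct P? (f ∘ suc) g) ⟩
    _                                                  ∎
    where
    open ≡-Reasoning
    xs = map (f zero ,_) (tabulate g)
    ys = cartesianProduct (tabulate (f ∘ suc)) (tabulate g)

  ∑-reindex : ∀ {n} (F : Fin n → ℕ) (f g : Fin n → Fin n) → (∀ i → f (g i) ≡ i) → (∀ i → g (f i) ≡ i) →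
    ∑[ i < n ] F (f i) ≡ ∑[ i < n ] F i
  ∑-reindex F f g fg gf = sym (∑-permute F (permutation f g fg gf))

  ∑-const : ∀ n c → ∑[ i < n ] c ≡ n * c
  ∑-const zero    c = refl
  ∑-const (suc n) c = cong (c +_) (∑-const n c)

  ∑-δ : ∀ {n} (j : Fin n) c → ∑[ i < n ] (𝟙 (i ≟ᶠ j) * c) ≡ c
  ∑-δ {suc n} zero    c = trans (cong₂ _+_ (ℕₚ.+-identityʳ c) (trans (∑-const n 0) (ℕₚ.*-zeroʳ n)))
      (ℕₚ.+-identityʳ c)
  ∑-δ {suc n} (suc j) c = ∑-δ j c

  -- Subtraction-free form of ∑F - ∑G = F j - G j. The corrections enter as sums of multiples of the
  -- indicator of j, which makes the two sides agree termwise.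
  ∑-agree-except : ∀ {n} (F G : Fin n → ℕ) j → (∀ i → i ≢ j → F i ≡ G i) →
    ∑[ i < n ] F i + G j ≡ ∑[ i < n ] G i + F j
  ∑-agree-except {n} F G j F≡G = begin
    ∑[ i < n ] F i + G j                             ≡⟨ cong (∑[ i < n ] F i +_) (∑-δ j (G j)) ⟨
    ∑[ i < n ] F i + ∑[ i < n ] (𝟙 (i ≟ᶠ j) * G j)     ≡⟨ ∑-distrib-+ F (λ i → 𝟙 (i ≟ᶠ j) * G j) ⟨
    ∑[ i < n ] (F i + 𝟙 (i ≟ᶠ j) * G j)              ≡⟨ sum-cong-≗ pointwise ⟩
    ∑[ i < n ] (G i + 𝟙 (i ≟ᶠ j) * F j)              ≡⟨ ∑-distrib-+ G (λ i → 𝟙 (i ≟ᶠ j) * F j) ⟩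
    ∑[ i < n ] G i + ∑[ i < n ] (𝟙 (i ≟ᶠ j) * F j)     ≡⟨ cong (∑[ i < n ] G i +_) (∑-δ j (F j)) ⟩
    ∑[ i < n ] G i + F j                             ∎
    where
    open ≡-Reasoning
    pointwise : ∀ i → F i + 𝟙 (i ≟ᶠ j) * G j ≡ G i + 𝟙 (i ≟ᶠ j) * F j
    pointwise i with i ≟ᶠ j
    ... | yes refl = solve 2 (λ x y → x :+ con 1 :* y := y :+ con 1 :* x) refl (F i) (G i)
        where open +-*-Solver
    ... | no i≢j   = cong (_+ 0) (F≡G i i≢j)

  -- Two single exchanges through `H`, which is F at j and G elsewhere.
  ∑-agree-except₂ : ∀ {n} (F G : Fin n → ℕ) {j k} → j ≢ k → (∀ i → i ≢ j → i ≢ k → F i ≡ G i) →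
    ∑[ i < n ] F i + (G j + G k) ≡ ∑[ i < n ] G i + (F j + F k)
  ∑-agree-except₂ {n} F G {j} {k} j≢k F≡G = ℕₚ.+-cancelˡ-≡ (sum H) _ _ (begin
    sum H + (sum F + (G j + G k))    ≡⟨ cong (λ z → sum H + (sum F + (G j + z))) Hk ⟨
    sum H + (sum F + (G j + H k))
      ≡⟨ solve 4 (λ a b c d → a :+ (b :+ (c :+ d)) := (b :+ d) :+ (a :+ c)) refl (sum H) (sum F) (G j) (H k) ⟩
    (sum F + H k) + (sum H + G j)    ≡⟨ cong₂ _+_ (∑-agree-except F H k F≡H) (∑-agree-except H G j H≡G) ⟩
    (sum H + F k) + (sum G + H j)    ≡⟨ cong (λ z → (sum H + F k) + (sum G + z)) Hj ⟩
    (sum H + F k) + (sum G + F j)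
      ≡⟨ solve 4 (λ a b c d → (a :+ d) :+ (b :+ c) := a :+ (b :+ (c :+ d))) refl (sum H) (sum G) (F j) (F k) ⟩
    sum H + (sum G + (F j + F k))    ∎)
    where
    open ≡-Reasoning
    open +-*-Solver
    H : Fin n → ℕ
    H i = if does (i ≟ᶠ j) then F i else G i
    Hj : H j ≡ F j
    Hj with j ≟ᶠ j
    ... | yes _ = refl
    ... | no ¬e = contradiction refl ¬e
    H≡G : ∀ i → i ≢ j → H i ≡ G i
    H≡G i i≢j with i ≟ᶠ j
    ... | yes e = contradiction e i≢j
    ... | no _  = refl
    Hk : H k ≡ G k
    Hk = H≡G k (j≢k ∘ sym)
    F≡H : ∀ i → i ≢ k → F i ≡ H i
    F≡H i i≢k with i ≟ᶠ j
    ... | yes _  = refl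
    ... | no i≢j = F≡G i i≢j i≢k

  ∑-≤ : ∀ {n} (F : Fin n → ℕ) → (∀ i → F i ≤ 1) → ∑[ i < n ] F i ≤ n
  ∑-≤ {zero}  F F≤1 = z≤n
  ∑-≤ {suc n} F F≤1 = ℕₚ.+-mono-≤ (F≤1 zero) (∑-≤ (F ∘ suc) (F≤1 ∘ suc))

  ∑≡0⇒ : ∀ {n} (F : Fin n → ℕ) → ∑[ i < n ] F i ≡ 0 → ∀ i → F i ≡ 0
  ∑≡0⇒ {suc n} F e zero    = ℕₚ.m+n≡0⇒m≡0 (F zero) e
  ∑≡0⇒ {suc n} F e (suc i) = ∑≡0⇒ (F ∘ suc) (ℕₚ.m+n≡0⇒n≡0 (F zero) e) i

  ∑≡n⇒ : ∀ {n} (F : Fin n → ℕ) → (∀ i → F i ≤ 1) → ∑[ i < n ] F i ≡ n → ∀ i → F i ≡ 1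
  ∑≡n⇒ {suc n} F F≤1 e = ∀-cons F₀≡1
      (∑≡n⇒ (F ∘ suc) (F≤1 ∘ suc) (ℕₚ.suc-injective (trans (cong (_+ sum (F ∘ suc)) (sym F₀≡1)) e)))
    where
    F₀≡1 : F zero ≡ 1
    F₀≡1 = ℕₚ.≤-antisym (F≤1 zero) (ℕₚ.+-cancelʳ-≤ n 1 (F zero) (ℕₚ.≤-trans (ℕₚ.≤-reflexive (sym e))
      (ℕₚ.+-monoʳ-≤ (F zero) (∑-≤ (F ∘ suc) (F≤1 ∘ suc)))))

  -- Doubling keeps Gauss's formula free of division.
  ∑-toℕ : ∀ n → 2 * ∑[ i < n ] toℕ i ≡ n * ℕ.pred n
  ∑-toℕ zero    = refl
  ∑-toℕ (suc n) = begin
    2 * ∑[ i < n ] (1 + toℕ i)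
      ≡⟨ cong (2 *_) (trans (∑-distrib-+ {n} (λ _ → 1) toℕ) (cong (_+ ∑[ i < n ] toℕ i) (∑-const n 1))) ⟩
    2 * (n * 1 + ∑[ i < n ] toℕ i)                   ≡⟨ ℕₚ.*-distribˡ-+ 2 (n * 1) _ ⟩
    2 * (n * 1) + 2 * ∑[ i < n ] toℕ i               ≡⟨ cong (2 * (n * 1) +_) (∑-toℕ n) ⟩
    2 * (n * 1) + n * ℕ.pred n                       ≡⟨ lem n ⟩
    suc n * n                                        ∎
    where
    open ≡-Reasoning
    open +-*-Solver
    lem : ∀ n → 2 * (n * 1) + n * ℕ.pred n ≡ suc n * n
    lem zero    = refl
    lem (suc n) = solve 1 (λ n → con 2 :* ((con 1 :+ n) :* con 1) :+ (con 1 :+ n) :* n :=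
        (con 2 :+ n) :* (con 1 :+ n)) refl n

open Counting

module Plane (p : ℕ) (p-prime : Prime p) where

  -- Arithmetic modulo p

  instance
    p-nonZero : NonZero p
    p-nonZero = prime⇒nonZero p-prime

  open AffinePlane p public

  1<p : 1 ℕ.< p
  1<p = ℕ.nonTrivial⇒n>1 p {{prime⇒nonTrivial p-prime}}

  infix 8 -_

  -- The quotient map from ℕ, with section `toℕ`. Being a surjective homomorphism, it carries every
  -- semiring law over from ℕ.
  φ : ℕ → 𝔽
  φ m = m mod p

  1# : 𝔽
  1# = φ 1

  -- Negation as multiplication by p - 1 makes every expression with signs a semiring expression in
  -- one more unknown, which the semiring solver can already handle.
  -_ : 𝔽 → 𝔽
  - a = φ (p ∸ 1) * a

  toℕ-φ : ∀ m → toℕ (φ m) ≡ m % p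
  toℕ-φ m = toℕ-fromℕ< (m%n<n m p)

  φ-toℕ : ∀ a → φ (toℕ a) ≡ a
  φ-toℕ a = toℕ-injective (trans (toℕ-φ (toℕ a)) (m<n⇒m%n≡m (toℕ<n a)))

  toℕ-φ-< : ∀ {m} → m ℕ.< p → toℕ (φ m) ≡ m
  toℕ-φ-< {m} m<p = trans (toℕ-φ m) (m<n⇒m%n≡m m<p)

  φ-+ : ∀ m n → φ (m ℕ.+ n) ≡ φ m + φ n
  φ-+ m n = toℕ-injective (begin
    toℕ (φ (m ℕ.+ n))                  ≡⟨ toℕ-φ (m ℕ.+ n) ⟩
    (m ℕ.+ n) % p                      ≡⟨ %-distribˡ-+ m n p ⟩
    (m % p ℕ.+ n % p) % p              ≡⟨ cong₂ (λ u v → (u ℕ.+ v) % p) (toℕ-φ m) (toℕ-φ n) ⟨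
    (toℕ (φ m) ℕ.+ toℕ (φ n)) % p      ≡⟨ toℕ-φ _ ⟨
    toℕ (φ m + φ n)                    ∎)
    where open ≡-Reasoning

  φ-* : ∀ m n → φ (m ℕ.* n) ≡ φ m * φ n
  φ-* m n = toℕ-injective (begin
    toℕ (φ (m ℕ.* n))                  ≡⟨ toℕ-φ (m ℕ.* n) ⟩
    (m ℕ.* n) % p                      ≡⟨ %-distribˡ-* m n p ⟩
    (m % p ℕ.* (n % p)) % p            ≡⟨ cong₂ (λ u v → (u ℕ.* v) % p) (toℕ-φ m) (toℕ-φ n) ⟨
    (toℕ (φ m) ℕ.* toℕ (φ n)) % p      ≡⟨ toℕ-φ _ ⟨
    toℕ (φ m * φ n)                    ∎)
    where open ≡-Reasoning

  φ-p : φ p ≡ 0#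
  φ-p = toℕ-injective (trans (toℕ-φ p) (trans (n%n≡0 p) (sym (toℕ-φ-< (ℕₚ.<-trans ℕ.z<s 1<p)))))

  +-comm : ∀ a b → a + b ≡ b + a
  +-comm a b = cong φ (ℕₚ.+-comm (toℕ a) (toℕ b))

  *-comm : ∀ a b → a * b ≡ b * a
  *-comm a b = cong φ (ℕₚ.*-comm (toℕ a) (toℕ b))

  +-assoc : ∀ a b c → (a + b) + c ≡ a + (b + c)
  +-assoc a b c = begin
    (a + b) + c                          ≡⟨ cong (a + b +_) (φ-toℕ c) ⟨
    φ (toℕ a ℕ.+ toℕ b) + φ (toℕ c)      ≡⟨ φ-+ (toℕ a ℕ.+ toℕ b) (toℕ c) ⟨
    φ ((toℕ a ℕ.+ toℕ b) ℕ.+ toℕ c)      ≡⟨ cong φ (ℕₚ.+-assoc (toℕ a) (toℕ b) (toℕ c)) ⟩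
    φ (toℕ a ℕ.+ (toℕ b ℕ.+ toℕ c))      ≡⟨ φ-+ (toℕ a) (toℕ b ℕ.+ toℕ c) ⟩
    φ (toℕ a) + φ (toℕ b ℕ.+ toℕ c)      ≡⟨ cong (_+ (b + c)) (φ-toℕ a) ⟩
    a + (b + c)                          ∎
    where open ≡-Reasoning

  *-assoc : ∀ a b c → (a * b) * c ≡ a * (b * c)
  *-assoc a b c = begin
    (a * b) * c                          ≡⟨ cong (a * b *_) (φ-toℕ c) ⟨
    φ (toℕ a ℕ.* toℕ b) * φ (toℕ c)      ≡⟨ φ-* (toℕ a ℕ.* toℕ b) (toℕ c) ⟨
    φ ((toℕ a ℕ.* toℕ b) ℕ.* toℕ c)      ≡⟨ cong φ (ℕₚ.*-assoc (toℕ a) (toℕ b) (toℕ c)) ⟩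
    φ (toℕ a ℕ.* (toℕ b ℕ.* toℕ c))      ≡⟨ φ-* (toℕ a) (toℕ b ℕ.* toℕ c) ⟩
    φ (toℕ a) * φ (toℕ b ℕ.* toℕ c)      ≡⟨ cong (_* (b * c)) (φ-toℕ a) ⟩
    a * (b * c)                          ∎
    where open ≡-Reasoning

  *-distribˡ-+ : ∀ a b c → a * (b + c) ≡ a * b + a * c
  *-distribˡ-+ a b c = begin
    a * (b + c)                                   ≡⟨ cong (_* (b + c)) (φ-toℕ a) ⟨
    φ (toℕ a) * φ (toℕ b ℕ.+ toℕ c)               ≡⟨ φ-* (toℕ a) (toℕ b ℕ.+ toℕ c) ⟨
    φ (toℕ a ℕ.* (toℕ b ℕ.+ toℕ c))               ≡⟨ cong φ (ℕₚ.*-distribˡ-+ (toℕ a) (toℕ b) (toℕ c)) ⟩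
    φ (toℕ a ℕ.* toℕ b ℕ.+ toℕ a ℕ.* toℕ c)       ≡⟨ φ-+ (toℕ a ℕ.* toℕ b) (toℕ a ℕ.* toℕ c) ⟩
    a * b + a * c                                 ∎
    where open ≡-Reasoning

  *-distribʳ-+ : ∀ a b c → (b + c) * a ≡ b * a + c * a
  *-distribʳ-+ a b c = trans (*-comm (b + c) a)
    (trans (*-distribˡ-+ a b c) (cong₂ _+_ (*-comm a b) (*-comm a c)))

  +-identityˡ : ∀ a → 0# + a ≡ a
  +-identityˡ a = trans (cong (0# +_) (sym (φ-toℕ a))) (trans (sym (φ-+ 0 (toℕ a))) (φ-toℕ a))

  *-identityˡ : ∀ a → 1# * a ≡ a
  *-identityˡ a = begin
    1# * a                ≡⟨ cong (1# *_) (φ-toℕ a) ⟨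
    1# * φ (toℕ a)        ≡⟨ φ-* 1 (toℕ a) ⟨
    φ (1 ℕ.* toℕ a)       ≡⟨ cong φ (ℕₚ.*-identityˡ (toℕ a)) ⟩
    φ (toℕ a)             ≡⟨ φ-toℕ a ⟩
    a                     ∎
    where open ≡-Reasoning

  *-zeroˡ : ∀ a → 0# * a ≡ 0#
  *-zeroˡ a = trans (cong (0# *_) (sym (φ-toℕ a))) (sym (φ-* 0 (toℕ a)))

  1+[-1]≡0 : 1# + φ (p ∸ 1) ≡ 0#
  1+[-1]≡0 = begin
    1# + φ (p ∸ 1)       ≡⟨ φ-+ 1 (p ∸ 1) ⟨
    φ (1 ℕ.+ (p ∸ 1))    ≡⟨ cong φ (ℕₚ.m+[n∸m]≡n (ℕₚ.<⇒≤ 1<p)) ⟩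
    φ p                  ≡⟨ φ-p ⟩
    0#                   ∎
    where open ≡-Reasoning

  -‿inverseʳ : ∀ a → a + - a ≡ 0#
  -‿inverseʳ a = begin
    a + - a                       ≡⟨ cong (_+ - a) (*-identityˡ a) ⟨
    1# * a + φ (p ∸ 1) * a        ≡⟨ *-distribʳ-+ a 1# (φ (p ∸ 1)) ⟨
    (1# + φ (p ∸ 1)) * a          ≡⟨ cong (_* a) 1+[-1]≡0 ⟩
    0# * a                        ≡⟨ *-zeroˡ a ⟩
    0#                            ∎
    where open ≡-Reasoning

  +-*-commutativeRing : CommutativeRing 0ℓ 0ℓ
  +-*-commutativeRing = record
    { Carrier = 𝔽 ; _≈_ = _≡_ ; _+_ = _+_ ; _*_ = _*_ ; -_ = -_ ; 0# = 0# ; 1# = 1#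
    ; isCommutativeRing = record
      { isRing = record
        { +-isAbelianGroup = record
          { isGroup = record
            { isMonoid = record
              { isSemigroup = record
                { isMagma = record { isEquivalence = isEquivalence ; ∙-cong = cong₂ _+_ }
                ; assoc = +-assoc
                }
              ; identity = +-identityˡ , λ a → trans (+-comm a 0#) (+-identityˡ a)
              }
            ; inverse = (λ a → trans (+-comm (- a) a) (-‿inverseʳ a)) , -‿inverseʳ
            ; ⁻¹-cong = cong -_
            }
          ; comm = +-comm
          }
        ; *-cong = cong₂ _*_
        ; *-assoc = *-assoc
        ; *-identity = *-identityˡ , λ a → trans (*-comm a 1#) (*-identityˡ a)
        ; distrib = *-distribˡ-+ , *-distribʳ-+
        }
      ; *-comm = *-comm
      }
    }

  open CommutativeRing +-*-commutativeRing public using (commutativeSemiring; zeroʳ; +-identityʳ; *-identityʳ)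

  open import Algebra.Properties.AbelianGroup (CommutativeRing.+-abelianGroup +-*-commutativeRing) public
    using () renaming (∙-cancelˡ to +-cancelˡ)

  -- A ring solver for 𝔽

  private
    -1# : 𝔽
    -1# = φ (p ∸ 1)

    open Algebra.Solver.Ring.NaturalCoefficients.Default commutativeSemiring using ()
      renaming (solve to solveˢ; con to conˢ; _:+_ to _⊞_; _:*_ to _⊠_; _:=_ to _≔_)

  -- With q = -1: q q = 1 + q + q q = 1 + q (1 + q) = 1, using 1 + q = 0 twice.
  -1*-1≡1 : -1# * -1# ≡ 1#
  -1*-1≡1 = begin
    -1# * -1#                         ≡⟨ +-identityˡ _ ⟨
    0# + -1# * -1#                    ≡⟨ cong (_+ -1# * -1#) 1+[-1]≡0 ⟨
    1# + -1# + -1# * -1#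
      ≡⟨ solveˢ 1 (λ q → conˢ 1 ⊞ q ⊞ q ⊠ q ≔ conˢ 1 ⊞ q ⊠ (conˢ 1 ⊞ q)) refl -1# ⟩
    1# + -1# * (1# + -1#)             ≡⟨ cong (λ z → 1# + -1# * z) 1+[-1]≡0 ⟩
    1# + -1# * 0#                     ≡⟨ solveˢ 1 (λ q → conˢ 1 ⊞ q ⊠ conˢ 0 ≔ conˢ 1) refl -1# ⟩
    1#                                ∎
    where open ≡-Reasoning

  -- Formal differences of natural numbers serve as coefficients, since the
  -- normal forms of the solver must compute although p is a variable.
  differences : RawRing 0ℓ 0ℓ
  differences = record
    { Carrier = ℕ × ℕ
    ; _≈_     = _≡_
    ; _+_     = λ { (m , n) (k , l) → m ℕ.+ k , n ℕ.+ l }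
    ; _*_     = λ { (m , n) (k , l) → m ℕ.* k ℕ.+ n ℕ.* l , m ℕ.* l ℕ.+ n ℕ.* k }
    ; -_      = λ { (m , n) → n , m }
    ; 0#      = 0 , 0
    ; 1#      = 1 , 0
    }

  private
    -- The case split makes (0 , 0) and (1 , 0) denote `0#` and `1#` definitionally, so that solved
    -- equations contain the literal constants.
    ⟦_⟧ᵈ : ℕ × ℕ → 𝔽
    ⟦ m , zero ⟧ᵈ  = φ m
    ⟦ m , suc n ⟧ᵈ = φ m + - φ (suc n)

    ⟦⟧ᵈ-difference : ∀ m n → ⟦ m , n ⟧ᵈ ≡ φ m + - φ n
    ⟦⟧ᵈ-difference m zero    = solveˢ 2 (λ q a → a ≔ a ⊞ q ⊠ conˢ 0) refl -1# (φ m)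
    ⟦⟧ᵈ-difference m (suc n) = refl

    morphism : differences -Raw-AlmostCommutative⟶ fromCommutativeRing +-*-commutativeRing
    morphism = record
      { ⟦_⟧ = ⟦_⟧ᵈ
      ; +-homo = λ { (m , n) (k , l) →
          trans (⟦⟧ᵈ-difference (m ℕ.+ k) (n ℕ.+ l))
          (trans (cong₂ (λ u v → u + - v) (φ-+ m k) (φ-+ n l)) (trans
          (solveˢ 5 (λ q a b c d → (a ⊞ c) ⊞ q ⊠ (b ⊞ d) ≔ (a ⊞ q ⊠ b) ⊞ (c ⊞ q ⊠ d))
            refl -1# (φ m) (φ n) (φ k) (φ l))
          (sym (cong₂ _+_ (⟦⟧ᵈ-difference m n) (⟦⟧ᵈ-difference k l))))) }
      ; *-homo = λ { (m , n) (k , l) → *-homo m n k l }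
      ; -‿homo = λ { (m , n) → -‿homo m n }
      ; 0-homo = refl
      ; 1-homo = refl
      }
      where
      open ≡-Reasoning
      *-homo : ∀ m n k l → ⟦ m ℕ.* k ℕ.+ n ℕ.* l , m ℕ.* l ℕ.+ n ℕ.* k ⟧ᵈ ≡ ⟦ m , n ⟧ᵈ * ⟦ k , l ⟧ᵈ
      *-homo m n k l = begin
        ⟦ m ℕ.* k ℕ.+ n ℕ.* l , m ℕ.* l ℕ.+ n ℕ.* k ⟧ᵈ
          ≡⟨ ⟦⟧ᵈ-difference (m ℕ.* k ℕ.+ n ℕ.* l) (m ℕ.* l ℕ.+ n ℕ.* k) ⟩
        φ (m ℕ.* k ℕ.+ n ℕ.* l) + - φ (m ℕ.* l ℕ.+ n ℕ.* k)
          ≡⟨ cong₂ (λ u v → u + - v) (φ-+* m k n l) (φ-+* m l n k) ⟩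
        (a * c + b * d) + -1# * (a * d + b * c)
          ≡⟨ cong (λ z → a * c + z + -1# * (a * d + b * c))
               (trans (cong (_* (b * d)) -1*-1≡1) (*-identityˡ (b * d))) ⟨
        (a * c + -1# * -1# * (b * d)) + -1# * (a * d + b * c)
          ≡⟨ solveˢ 5 (λ q a b c d → a ⊠ c ⊞ q ⊠ q ⊠ (b ⊠ d) ⊞ q ⊠ (a ⊠ d ⊞ b ⊠ c)
               ≔ (a ⊞ q ⊠ b) ⊠ (c ⊞ q ⊠ d)) refl -1# a b c d ⟩
        (a + - b) * (c + - d)
          ≡⟨ cong₂ _*_ (⟦⟧ᵈ-difference m n) (⟦⟧ᵈ-difference k l) ⟨
        ⟦ m , n ⟧ᵈ * ⟦ k , l ⟧ᵈ ∎
        where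
        a = φ m
        b = φ n
        c = φ k
        d = φ l
        φ-+* : ∀ m k n l → φ (m ℕ.* k ℕ.+ n ℕ.* l) ≡ φ m * φ k + φ n * φ l
        φ-+* m k n l = trans (φ-+ (m ℕ.* k) (n ℕ.* l)) (cong₂ _+_ (φ-* m k) (φ-* n l))
      -‿homo : ∀ m n → ⟦ n , m ⟧ᵈ ≡ - ⟦ m , n ⟧ᵈ
      -‿homo m n = begin
        ⟦ n , m ⟧ᵈ                        ≡⟨ ⟦⟧ᵈ-difference n m ⟩
        φ n + - φ m
          ≡⟨ cong (_+ - φ m) (trans (cong (_* φ n) -1*-1≡1) (*-identityˡ (φ n))) ⟨
        -1# * -1# * φ n + -1# * φ m
          ≡⟨ solveˢ 3 (λ q a b → q ⊠ q ⊠ b ⊞ q ⊠ a ≔ q ⊠ (a ⊞ q ⊠ b)) refl -1# (φ m) (φ n) ⟩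
        - (φ m + - φ n)                   ≡⟨ cong -_ (⟦⟧ᵈ-difference m n) ⟨
        - ⟦ m , n ⟧ᵈ                      ∎

    -- Coefficients are compared as integers, not modulo p: this is sound for every p and computes
    -- on numerals.
    _≟ᵈ_ : (x y : ℕ × ℕ) → Maybe (⟦ x ⟧ᵈ ≡ ⟦ y ⟧ᵈ)
    (m , n) ≟ᵈ (k , l) with m ℕ.+ l ℕ.≟ k ℕ.+ n
    ... | no _  = nothing
    ... | yes e = just (begin
      ⟦ m , n ⟧ᵈ                          ≡⟨ ⟦⟧ᵈ-difference m n ⟩
      φ m + - φ n                         ≡⟨ +-identityʳ _ ⟨
      φ m + - φ n + 0#                    ≡⟨ cong (φ m + - φ n +_) (-‿inverseʳ (φ l)) ⟨
      φ m + - φ n + (φ l + - φ l)         ≡⟨ swap -1# (φ m) (φ n) (φ l) ⟩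
      φ m + φ l + (- φ n + - φ l)
        ≡⟨ cong (_+ (- φ n + - φ l)) (trans (sym (φ-+ m l)) (trans (cong φ e) (φ-+ k n))) ⟩
      φ k + φ n + (- φ n + - φ l)
        ≡⟨ solveˢ 4 (λ q a b c → a ⊞ b ⊞ (q ⊠ b ⊞ q ⊠ c) ≔ a ⊞ q ⊠ c ⊞ (b ⊞ q ⊠ b)) refl -1# (φ k) (φ n)
             (φ l) ⟩
      φ k + - φ l + (φ n + - φ n)         ≡⟨ cong (φ k + - φ l +_) (-‿inverseʳ (φ n)) ⟩
      φ k + - φ l + 0#                    ≡⟨ +-identityʳ _ ⟩
      φ k + - φ l                         ≡⟨ ⟦⟧ᵈ-difference k l ⟨
      ⟦ k , l ⟧ᵈ                          ∎)
      where
      open ≡-Reasoning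
      swap : ∀ q a b c → a + q * b + (c + q * c) ≡ a + c + (q * b + q * c)
      swap = solveˢ 4 (λ q a b c → a ⊞ q ⊠ b ⊞ (c ⊞ q ⊠ c) ≔ a ⊞ c ⊞ (q ⊠ b ⊞ q ⊠ c)) refl

  module 𝔽-Solver = Algebra.Solver.Ring differences (fromCommutativeRing +-*-commutativeRing) morphism _≟ᵈ_

  open 𝔽-Solver using (solve; con; _:+_; _:*_; :-_; _:=_)

  :0 :1 : ∀ {n} → 𝔽-Solver.Polynomial n
  :0 = con (0 , 0)
  :1 = con (1 , 0)

  abstract
    1≢0 : 1# ≢ 0#
    1≢0 e = ℕₚ.1+n≢0 (trans (sym (toℕ-φ-< 1<p)) (trans (cong toℕ e) (toℕ-φ-< (ℕₚ.<-trans ℕ.z<s 1<p))))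

    toℕ-0# : toℕ 0# ≡ 0
    toℕ-0# = toℕ-φ-< (ℕₚ.<-trans ℕ.z<s 1<p)

    -- Bézout coefficients of p and a. Over ℕ they come in two shapes: 1 + y a = x p, where the
    -- inverse is -y, and 1 + x p = y a, where it is y.
    inverse : ∀ a → a ≢ 0# → ∃ λ b → b * a ≡ 1#
    inverse a a≢0 with coprime-Bézout
        (prime⇒coprime p-prime {{ℕ.≢-nonZero λ e → a≢0 (trans (sym (φ-toℕ a)) (cong φ e))}} (toℕ<n a))
    ... | Bézout.+- x y e = - φ y , (begin
        - φ y * a               ≡⟨ solve 2 (λ y a → :- y :* a := :1 :+ :- (:1 :+ y :* a)) refl (φ y) a ⟩
        1# + - (1# + φ y * a)   ≡⟨ cong (λ z → 1# + - z) (begin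
          1# + φ y * a              ≡⟨ cong (λ z → 1# + φ y * z) (φ-toℕ a) ⟨
          1# + φ y * φ (toℕ a)      ≡⟨ cong (1# +_) (φ-* y (toℕ a)) ⟨
          1# + φ (y ℕ.* toℕ a)      ≡⟨ φ-+ 1 (y ℕ.* toℕ a) ⟨
          φ (1 ℕ.+ y ℕ.* toℕ a)     ≡⟨ cong φ e ⟩
          φ (x ℕ.* p)               ≡⟨ φ-* x p ⟩
          φ x * φ p                 ≡⟨ cong (φ x *_) φ-p ⟩
          φ x * 0#                  ∎) ⟩
        1# + - (φ x * 0#)       ≡⟨ solve 1 (λ x → :1 :+ :- (x :* :0) := :1) refl (φ x) ⟩
        1#                      ∎)
        where open ≡-Reasoning
    ... | Bézout.-+ x y e = φ y , (begin
        φ y * a                 ≡⟨ cong (φ y *_) (φ-toℕ a) ⟨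
        φ y * φ (toℕ a)         ≡⟨ φ-* y (toℕ a) ⟨
        φ (y ℕ.* toℕ a)         ≡⟨ cong φ e ⟨
        φ (1 ℕ.+ x ℕ.* p)       ≡⟨ φ-+ 1 (x ℕ.* p) ⟩
        1# + φ (x ℕ.* p)        ≡⟨ cong (1# +_) (trans (φ-* x p) (cong (φ x *_) φ-p)) ⟩
        1# + φ x * 0#           ≡⟨ solve 1 (λ x → :1 :+ x :* :0 := :1) refl (φ x) ⟩
        1#                      ∎)
        where open ≡-Reasoning

    *-cancelˡ-nonZero : ∀ a {b c} → a ≢ 0# → a * b ≡ a * c → b ≡ c
    *-cancelˡ-nonZero a {b} {c} a≢0 e with inverse a a≢0
    ... | i , ia≡1 = begin
      b              ≡⟨ *-identityˡ b ⟨
      1# * b         ≡⟨ cong (_* b) ia≡1 ⟨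
      i * a * b      ≡⟨ *-assoc i a b ⟩
      i * (a * b)    ≡⟨ cong (i *_) e ⟩
      i * (a * c)    ≡⟨ *-assoc i a c ⟨
      i * a * c      ≡⟨ cong (_* c) ia≡1 ⟩
      1# * c         ≡⟨ *-identityˡ c ⟩
      c              ∎
      where open ≡-Reasoning

    *-nonZero : ∀ {a b} → a ≢ 0# → b ≢ 0# → a * b ≢ 0#
    *-nonZero {a} {b} a≢0 b≢0 ab≡0 = b≢0 (*-cancelˡ-nonZero a a≢0 (trans ab≡0 (sym (zeroʳ a))))

  -- Line sums

  χ : Subset → 𝔽² → ℕ
  χ S q = 𝟙 (mem? S q)

  χ-ᶜ : ∀ S q → χ S q ℕ.+ χ (S ᶜ) q ≡ 1
  χ-ᶜ S q = 𝟙-complement (mem? S q)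

  abstract
    size-∑ : ∀ S → size S ≡ ∑[ x < p ] ∑[ y < p ] χ S (x , y)
    size-∑ S = length-filter-cartesianProduct (mem? S) id id

  points! : Unique points
  points! = Uniqueₚ.cartesianProduct⁺ (Uniqueₚ.allFin⁺ p) (Uniqueₚ.allFin⁺ p)

  ∈-points : ∀ q → q Mem.∈ points
  ∈-points (x , y) = ∈-cartesianProduct⁺ (∈-allFin x) (∈-allFin y)

  abstract
    ⊕·-injective : ∀ q (d : Direction) {s t} → q ⊕ s · proj₁ d ≡ q ⊕ t · proj₁ d → s ≡ t
    ⊕·-injective (x , y) ((u , v) , uv≢𝟎) {s} {t} e with u ≟ᶠ 0# | v ≟ᶠ 0#
    ... | yes u≡0 | yes v≡0 = contradiction (cong₂ _,_ u≡0 v≡0) uv≢𝟎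
    ... | no u≢0  | _       = *-cancelˡ-nonZero u u≢0
        (trans (*-comm u s) (trans (+-cancelˡ x _ _ (cong proj₁ e)) (*-comm t u)))
    ... | yes _   | no v≢0  = *-cancelˡ-nonZero v v≢0
        (trans (*-comm v s) (trans (+-cancelˡ y _ _ (cong proj₂ e)) (*-comm t v)))

    -- A direction is nonzero, so the parametrisation of the line is injective, and a count over p²
    -- points becomes a sum over p parameters.
    size-∩-line : ∀ S q d → size (S ∩ line q d) ≡ ∑[ t < p ] χ S (q ⊕ t · proj₁ d)
    size-∩-line S q d = begin
      size (S ∩ line q d)
        ≡⟨ length-filter-↣ (mem? S ∘ λ t → q ⊕ t · proj₁ d) (mem? (S ∩ line q d))
        (Uniqueₚ.allFin⁺ p) points! ∈-allFin ∈-points (λ t → q ⊕ t · proj₁ d) (⊕·-injective q d)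
        (λ t q∈S → q∈S , t , refl) (λ { _ (q∈S , t , refl) → t , q∈S , refl }) ⟨
      length (filter (mem? S ∘ λ t → q ⊕ t · proj₁ d) (allFin p))
        ≡⟨ length-filter-tabulate (mem? S ∘ λ t → q ⊕ t · proj₁ d) id ⟩
      ∑[ t < p ] χ S (q ⊕ t · proj₁ d)                                  ∎
      where open ≡-Reasoning

    ∑-translate : ∀ (F : 𝔽 → ℕ) a → ∑[ t < p ] F (a + t) ≡ ∑[ t < p ] F t
    ∑-translate F a = ∑-reindex F (a +_) (- a +_)
      (solve 2 (λ a t → a :+ (:- a :+ t) := t) refl a) (solve 2 (λ a t → :- a :+ (a :+ t) := t) refl a)

    ∑-dilate : ∀ (F : 𝔽 → ℕ) {c} → c ≢ 0# → ∑[ t < p ] F (t * c) ≡ ∑[ t < p ] F t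
    ∑-dilate F {c} c≢0 with inverse c c≢0
    ... | i , ic≡1 = ∑-reindex F (_* c) (_* i)
      (λ t → trans (*-assoc t i c) (trans (cong (t *_) ic≡1) (*-identityʳ t)))
      (λ t → trans (*-assoc t c i) (trans (cong (t *_) (trans (*-comm c i) ic≡1)) (*-identityʳ t)))

    ∑-affine : ∀ (F : 𝔽 → ℕ) a {c} → c ≢ 0# → ∑[ t < p ] F (a + t * c) ≡ ∑[ t < p ] F t
    ∑-affine F a c≢0 = trans (∑-dilate (F ∘ (a +_)) c≢0) (∑-translate F a)

  [0,1]≢𝟎 : (0# , 1#) ≢ 𝟎
  [0,1]≢𝟎 = 1≢0 ∘ cong proj₂

  [1,m]≢𝟎 : ∀ m → (1# , m) ≢ 𝟎
  [1,m]≢𝟎 m = 1≢0 ∘ cong proj₁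

  vertical : Direction
  vertical = (0# , 1#) , [0,1]≢𝟎

  slope : 𝔽 → Direction
  slope m = (1# , m) , [1,m]≢𝟎 m

  -- The counts A, B and C; `diag S z` belongs to the line of points whose coordinates add up to z.
  col row diag : Subset → 𝔽 → ℕ
  col S x  = ∑[ y < p ] χ S (x , y)
  row S y  = ∑[ x < p ] χ S (x , y)
  diag S z = ∑[ x < p ] χ S (x , z + - x)

  abstract
    size-vertical : ∀ S x y → size (S ∩ line (x , y) vertical) ≡ col S x
    size-vertical S x y = begin
      size (S ∩ line (x , y) vertical)             ≡⟨ size-∩-line S (x , y) vertical ⟩
      ∑[ t < p ] χ S (x + t * 0# , y + t * 1#)     ≡⟨ sum-cong-≗ (λ t → cong₂ (λ u v → χ S (u , v))
        (solve 2 (λ x t → x :+ t :* :0 := x) refl x t) (solve 2 (λ y t → y :+ t :* :1 := y :+ t) refl y t)) ⟩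
      ∑[ t < p ] χ S (x , y + t)                   ≡⟨ ∑-translate (λ t → χ S (x , t)) y ⟩
      col S x                                      ∎
      where open ≡-Reasoning

    size-horizontal : ∀ S x y → size (S ∩ line (x , y) (slope 0#)) ≡ row S y
    size-horizontal S x y = begin
      size (S ∩ line (x , y) (slope 0#))           ≡⟨ size-∩-line S (x , y) (slope 0#) ⟩
      ∑[ t < p ] χ S (x + t * 1# , y + t * 0#)     ≡⟨ sum-cong-≗ (λ t → cong₂ (λ u v → χ S (u , v))
        (solve 2 (λ y t → y :+ t :* :1 := y :+ t) refl x t) (solve 2 (λ x t → x :+ t :* :0 := x) refl y t)) ⟩
      ∑[ t < p ] χ S (x + t , y)                   ≡⟨ ∑-translate (λ t → χ S (t , y)) x ⟩
      row S y                                      ∎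
      where open ≡-Reasoning

    size-diagonal : ∀ S x y → size (S ∩ line (x , y) (slope (- 1#))) ≡ diag S (x + y)
    size-diagonal S x y = begin
      size (S ∩ line (x , y) (slope (- 1#)))              ≡⟨ size-∩-line S (x , y) (slope (- 1#)) ⟩
      ∑[ t < p ] χ S (x + t * 1# , y + t * - 1#)          ≡⟨ sum-cong-≗ (λ t → cong₂ (λ u v → χ S (u , v))
        (solve 2 (λ y t → y :+ t :* :1 := y :+ t) refl x t)
        (solve 3 (λ x y t → y :+ t :* :- :1 := (x :+ y) :+ :- (x :+ t)) refl x y t)) ⟩
      ∑[ t < p ] χ S (x + t , (x + y) + - (x + t))        ≡⟨ ∑-translate (λ t → χ S (t , (x + y) + - t)) x ⟩
      diag S (x + y)                                      ∎
      where open ≡-Reasoning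

    -- The lines through q cover q once per direction and every other point once.
    ∑-pencil : ∀ S q → ∑[ m < p ] size (S ∩ line q (slope m)) ℕ.+ size (S ∩ line q vertical)
      ≡ size S ℕ.+ p ℕ.* χ S q
    ∑-pencil S (x , y) = begin
      ∑[ m < p ] size (S ∩ line (x , y) (slope m)) ℕ.+ size (S ∩ line (x , y) vertical)
        ≡⟨ cong₂ ℕ._+_ (trans (sum-cong-≗ (λ m → trans (size-∩-line S (x , y) (slope m))
             (sum-cong-≗ (λ t → cong (λ u → χ S (x + u , y + t * m)) (*-identityʳ t)))))
             (∑-comm (λ m t → χ S (x + t , y + t * m))))
           (trans (size-vertical S x y) (cong (col S) (sym (x+0 x)))) ⟩
      -- For t ≠ 0 the ordinate `y + t * m` runs through the whole column as m varies. At t = 0 all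
      -- p lines pass through the point itself, and the vertical line supplies the missing column.
      ∑[ t < p ] G t ℕ.+ col S (x + 0#)
        ≡⟨ ∑-agree-except G (λ t → col S (x + t)) 0# (λ t t≢0 → trans
             (sum-cong-≗ (λ m → cong (λ u → χ S (x + t , y + u)) (*-comm t m)))
             (∑-affine (λ u → χ S (x + t , u)) y t≢0)) ⟩
      ∑[ t < p ] col S (x + t) ℕ.+ G 0#
        ≡⟨ cong₂ ℕ._+_ (trans (∑-translate (col S) x) (sym (size-∑ S)))
           (trans (sum-cong-≗ (λ m → cong₂ (λ u v → χ S (u , v)) (x+0 x)
               (solve 2 (λ y m → y :+ :0 :* m := y) refl y m)))
             (∑-const p (χ S (x , y)))) ⟩
      size S ℕ.+ p ℕ.* χ S (x , y) ∎
      where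
      open ≡-Reasoning
      G : 𝔽 → ℕ
      G t = ∑[ m < p ] χ S (x + t , y + t * m)
      x+0 : ∀ x → x + 0# ≡ x
      x+0 = +-identityʳ

    -- This includes p = 2, where -1 = 1 and the slopes 0 and -1 are already all slopes.
    0≢-1 : 0# ≢ - 1#
    0≢-1 e = 1≢0 (trans (solve 0 (:1 := :1 :+ :0) refl) (trans (cong (1# +_) e) (-‿inverseʳ 1#)))

    -- Compare the pencils through the two points: the size of S and all equidistributed slopes
    -- cancel, leaving the three exceptional lines through each point.
    exchange : ∀ S → (∀ m → m ≢ 0# → m ≢ - 1# → Equidistributed S (slope m)) → ∀ x y u v →
      p ℕ.* χ S (x , y) ℕ.+ (col S u ℕ.+ (row S v ℕ.+ diag S (u + v)))
      ≡ p ℕ.* χ S (u , v) ℕ.+ (col S x ℕ.+ (row S y ℕ.+ diag S (x + y)))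
    exchange S eq x y u v = ℕₚ.+-cancelˡ-≡ (size S ℕ.+ F u v) _ _ (begin
      size S ℕ.+ F u v ℕ.+ (p ℕ.* χ S (x , y) ℕ.+ (col S u ℕ.+ E u v))
        ≡⟨ ℕ-solve 5 (λ s f c a e → s ⊹ f ⊹ (c ⊹ (a ⊹ e)) ⊜ (s ⊹ c) ⊹ (f ⊹ a) ⊹ e) refl
             (size S) (F u v) (p ℕ.* χ S (x , y)) (col S u) (E u v) ⟩
      size S ℕ.+ p ℕ.* χ S (x , y) ℕ.+ (F u v ℕ.+ col S u) ℕ.+ E u v
        ≡⟨ cong (ℕ._+ E u v) (cong₂ ℕ._+_ (sym (pencil x y)) (pencil u v)) ⟩
      F x y ℕ.+ col S x ℕ.+ (size S ℕ.+ p ℕ.* χ S (u , v)) ℕ.+ E u v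
        ≡⟨ ℕ-solve 5 (λ f a s c e → f ⊹ a ⊹ (s ⊹ c) ⊹ e ⊜ s ⊹ c ⊹ a ⊹ (f ⊹ e)) refl
             (F x y) (col S x) (size S) (p ℕ.* χ S (u , v)) (E u v) ⟩
      size S ℕ.+ p ℕ.* χ S (u , v) ℕ.+ col S x ℕ.+ (F x y ℕ.+ E u v)
        ≡⟨ cong (size S ℕ.+ p ℕ.* χ S (u , v) ℕ.+ col S x ℕ.+_) two ⟩
      size S ℕ.+ p ℕ.* χ S (u , v) ℕ.+ col S x ℕ.+ (F u v ℕ.+ E x y)
        ≡⟨ ℕ-solve 5 (λ s c a f e → s ⊹ c ⊹ a ⊹ (f ⊹ e) ⊜ s ⊹ f ⊹ (c ⊹ (a ⊹ e))) refl
             (size S) (p ℕ.* χ S (u , v)) (col S x) (F u v) (E x y) ⟩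
      size S ℕ.+ F u v ℕ.+ (p ℕ.* χ S (u , v) ℕ.+ (col S x ℕ.+ E x y)) ∎)
      where
      open ≡-Reasoning
      open +-*-Solver using () renaming (solve to ℕ-solve; _:+_ to _⊹_; _:=_ to _⊜_)
      N : 𝔽 → 𝔽 → 𝔽 → ℕ
      N x y m = size (S ∩ line (x , y) (slope m))
      F E : 𝔽 → 𝔽 → ℕ
      F x y = ∑[ m < p ] N x y m
      E x y = row S y ℕ.+ diag S (x + y)
      pencil : ∀ x y → F x y ℕ.+ col S x ≡ size S ℕ.+ p ℕ.* χ S (x , y)
      pencil x y = trans (cong (F x y ℕ.+_) (sym (size-vertical S x y))) (∑-pencil S (x , y))
      N-E : ∀ x y → N x y 0# ℕ.+ N x y (- 1#) ≡ E x y
      N-E x y = cong₂ ℕ._+_ (size-horizontal S x y) (size-diagonal S x y)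
      two : F x y ℕ.+ E u v ≡ F u v ℕ.+ E x y
      two = trans (cong (F x y ℕ.+_) (sym (N-E u v))) (trans
        (∑-agree-except₂ (N x y) (N u v) 0≢-1 (λ m m≢0 m≢-1 → eq m m≢0 m≢-1 (x , y) (u , v)))
        (cong (F u v ℕ.+_) (N-E x y)))

  -- The classification in normal position

  abstract
    -- `1#` generates the additive group, so induction on n settles f at `φ n`, and every element
    -- has this form.
    additive⇒linear : ∀ (f : 𝔽 → 𝔽) → (∀ x y → f (x + y) ≡ f x + f y) → ∀ x → f x ≡ f 1# * x
    additive⇒linear f f-+ x = subst (λ x → f x ≡ f 1# * x) (φ-toℕ x) (linear (toℕ x))
      where
      open ≡-Reasoning
      f0≡0 : f 0# ≡ 0#
      f0≡0 = +-cancelˡ (f 0#) _ _ (trans (sym (f-+ 0# 0#))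
          (trans (cong f (+-identityʳ 0#)) (sym (+-identityʳ (f 0#)))))
      linear : ∀ n → f (φ n) ≡ f 1# * φ n
      linear zero    = trans f0≡0 (sym (zeroʳ (f 1#)))
      linear (suc n) = begin
        f (φ (suc n))            ≡⟨ cong f (φ-+ 1 n) ⟩
        f (1# + φ n)             ≡⟨ f-+ 1# (φ n) ⟩
        f 1# + f (φ n)           ≡⟨ cong (f 1# +_) (linear n) ⟩
        f 1# + f 1# * φ n        ≡⟨ solve 2 (λ f n → f :+ f :* n := f :* (:1 :+ n)) refl (f 1#) (φ n) ⟩
        f 1# * (1# + φ n)        ≡⟨ cong (f 1# *_) (φ-+ 1 n) ⟨
        f 1# * φ (suc n)         ∎

    -- The points (x , y) and (0 , x + y) have the same coordinate sum, so h cancels and f 0 + g (x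
    -- + y) = f x + g y. Putting y = 0 shows that g - f is constant; hence f - f 0 is additive, and
    -- therefore linear.
    Pexider : ∀ (f g h : 𝔽 → 𝔽) → (∀ x y u v → f u + (g v + h (u + v)) ≡ f x + (g y + h (x + y))) →
      ∃ λ α → (∀ x → f x ≡ α * x + f 0#) × (∀ x → g x ≡ α * x + g 0#)
    Pexider f g h eq = k 1# , f-affine , λ x →
        trans (g≡f x) (trans (cong (λ z → z + (g 0# + - f 0#)) (f-affine x))
        (solve 3 (λ a f g → (a :+ f) :+ (g :+ :- f) := a :+ g) refl (k 1# * x) (f 0#) (g 0#)))
      where
      open ≡-Reasoning
      k : 𝔽 → 𝔽
      k x = f x + - f 0#
      f₀+g : ∀ x y → f 0# + g (x + y) ≡ f x + g y
      f₀+g x y = begin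
        f 0# + g (x + y)
          ≡⟨ solve 3 (λ f g h → f :+ g := (f :+ (g :+ h)) :+ :- h) refl (f 0#) (g (x + y)) (h (x + y)) ⟩
        (f 0# + (g (x + y) + h (x + y))) + - h (x + y)
          ≡⟨ cong (λ z → (f 0# + (g (x + y) + h z)) + - h (x + y)) (+-identityˡ (x + y)) ⟨
        (f 0# + (g (x + y) + h (0# + (x + y)))) + - h (x + y)
          ≡⟨ cong (_+ - h (x + y)) (eq x y 0# (x + y)) ⟩
        (f x + (g y + h (x + y))) + - h (x + y)
          ≡⟨ solve 3 (λ f g h → (f :+ (g :+ h)) :+ :- h := f :+ g) refl (f x) (g y) (h (x + y)) ⟩
        f x + g y ∎
      g≡f : ∀ x → g x ≡ f x + (g 0# + - f 0#)
      g≡f x = +-cancelˡ (f 0#) _ _ (begin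
        f 0# + g x                    ≡⟨ cong (λ z → f 0# + g z) (+-identityʳ x) ⟨
        f 0# + g (x + 0#)             ≡⟨ f₀+g x 0# ⟩
        f x + g 0#
          ≡⟨ solve 3 (λ a f g → a :+ g := f :+ (a :+ (g :+ :- f))) refl (f x) (f 0#) (g 0#) ⟩
        f 0# + (f x + (g 0# + - f 0#)) ∎)
      k-+ : ∀ x y → k (x + y) ≡ k x + k y
      k-+ x y = begin
        f (x + y) + - f 0#
          ≡⟨ solve 3 (λ a f g → a :+ :- f := (f :+ (a :+ (g :+ :- f))) :+ (:- g :+ :- f)) refl (f (x + y))
               (f 0#) (g 0#) ⟩
        (f 0# + (f (x + y) + (g 0# + - f 0#))) + (- g 0# + - f 0#)
          ≡⟨ cong (λ z → (f 0# + z) + (- g 0# + - f 0#)) (g≡f (x + y)) ⟨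
        (f 0# + g (x + y)) + (- g 0# + - f 0#)
          ≡⟨ cong (_+ (- g 0# + - f 0#)) (f₀+g x y) ⟩
        (f x + g y) + (- g 0# + - f 0#)
          ≡⟨ cong (λ z → (f x + z) + (- g 0# + - f 0#)) (g≡f y) ⟩
        (f x + (f y + (g 0# + - f 0#))) + (- g 0# + - f 0#)
          ≡⟨ solve 4 (λ a b f g → (a :+ (b :+ (g :+ :- f))) :+ (:- g :+ :- f) := (a :+ :- f) :+ (b :+ :- f))
               refl (f x) (f y) (f 0#) (g 0#) ⟩
        k x + k y ∎
      f-affine : ∀ x → f x ≡ k 1# * x + f 0#
      f-affine x = trans (solve 2 (λ a f → a := (a :+ :- f) :+ f) refl (f x) (f 0#))
          (cong (_+ f 0#) (additive⇒linear k k-+ x))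

    affine-surjective : ∀ {α} → α ≢ 0# → ∀ β w → ∃ λ x → α * x + β ≡ w
    affine-surjective {α} α≢0 β w with inverse α α≢0
    ... | i , iα≡1 = i * (w + - β) , (begin
      α * (i * (w + - β)) + β
        ≡⟨ solve 4 (λ a i w b → a :* (i :* (w :+ :- b)) :+ b := (i :* a) :* (w :+ :- b) :+ b) refl α i w β ⟩
      i * α * (w + - β) + β      ≡⟨ cong (λ z → z * (w + - β) + β) iα≡1 ⟩
      1# * (w + - β) + β         ≡⟨ solve 2 (λ w b → :1 :* (w :+ :- b) :+ b := w) refl w β ⟩
      w                          ∎)
      where open ≡-Reasoning

    zero-slope⇒constant : ∀ (f : 𝔽 → 𝔽) {α β} → α ≡ 0# → (∀ x → f x ≡ α * x + β) → ∀ x y → f x ≡ f y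
    zero-slope⇒constant f {β = β} refl f-affine x y =
      trans (f-affine x) (trans (solve 3 (λ x y c → :0 :* x :+ c := :0 :* y :+ c) refl x y β)
          (sym (f-affine y)))

    φ-injective-≤ : ∀ {m n} → m ℕ.≤ p → n ℕ.≤ p → φ m ≡ φ n → m ≢ n → m ≡ 0 × n ≡ p ⊎ m ≡ p × n ≡ 0
    φ-injective-≤ {m} {n} m≤p n≤p e m≢n with ℕₚ.m≤n⇒m<n∨m≡n m≤p | ℕₚ.m≤n⇒m<n∨m≡n n≤p
    ... | inj₁ m<p  | inj₁ n<p  = contradiction (trans (sym (toℕ-φ-< m<p)) (trans (cong toℕ e) (toℕ-φ-< n<p)))
        m≢n
    ... | inj₁ m<p  | inj₂ refl = inj₁
        (trans (sym (toℕ-φ-< m<p)) (trans (cong toℕ (trans e φ-p)) toℕ-0#) , refl)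
    ... | inj₂ refl | inj₁ n<p  = inj₂
        (refl , trans (sym (toℕ-φ-< n<p)) (trans (cong toℕ (trans (sym e) φ-p)) toℕ-0#))
    ... | inj₂ refl | inj₂ n≡p  = contradiction (sym n≡p) m≢n

  col≤p : ∀ S x → col S x ℕ.≤ p
  col≤p S x = ∑-≤ _ λ y → 𝟙≤1 (mem? S (x , y))

  row≤p : ∀ S y → row S y ℕ.≤ p
  row≤p S y = ∑-≤ _ λ x → 𝟙≤1 (mem? S (x , y))

  diag≤p : ∀ S z → diag S z ℕ.≤ p
  diag≤p S z = ∑-≤ _ λ x → 𝟙≤1 (mem? S (x , z + - x))

  record NormalPosition (S : Subset) : Set where
    field
      equidistributed : ∀ m → m ≢ 0# → m ≢ - 1# → Equidistributed S (slope m)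
      vertical-special : Special S vertical
      horizontal-special : Special S (slope 0#)

  abstract
    -- Specialness is only a negated universal statement; a finite search with decidable equality
    -- turns it into witnesses.
    nonconstant : ∀ (f : 𝔽 → ℕ) → ¬ (∀ x y → f x ≡ f y) → ∃ λ x → ∃ λ y → f x ≢ f y
    nonconstant f ¬const with any? (λ x → any? λ y → ¬? (f x ℕ.≟ f y))
    ... | yes xy = xy
    ... | no ∄   = contradiction (λ x y → decidable-stable (f x ℕ.≟ f y) (λ fx≢fy → ∄ (x , y , fx≢fy))) ¬const

  -- The model set: pairs of least residues whose addition produces a carry.
  threshold : Subset
  threshold = record
    { mem  = λ { (x , y) → p ℕ.≤ toℕ x ℕ.+ toℕ y }
    ; mem? = λ { (x , y) → p ℕ.≤? toℕ x ℕ.+ toℕ y }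
    }

  -- Both coordinates are scaled by the same α because the column and row counts share their slope;
  -- such a map fixes every direction.
  Homothetic : Subset → Subset → Set
  Homothetic S T = ∃ λ α → α ≢ 0# × ∃ λ β → ∃ λ γ → ∀ x y → (x , y) ∈ S ⇔ (α * x + β , α * y + γ) ∈ T

  module _ (S : Subset) where

    empty-col : ∀ {x} → col S x ≡ 0 → ∀ y → χ S (x , y) ≡ 0
    empty-col e = ∑≡0⇒ _ e

    empty-row : ∀ {y} → row S y ≡ 0 → ∀ x → χ S (x , y) ≡ 0
    empty-row e = ∑≡0⇒ _ e

    full-col : ∀ {x} → col S x ≡ p → ∀ y → χ S (x , y) ≡ 1
    full-col e = ∑≡n⇒ _ (λ y → 𝟙≤1 (mem? S (_ , y))) e

    full-row : ∀ {y} → row S y ≡ p → ∀ x → χ S (x , y) ≡ 1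
    full-row e = ∑≡n⇒ _ (λ x → 𝟙≤1 (mem? S (x , _))) e

    full-diag : ∀ {z} → diag S z ≡ p → ∀ x → χ S (x , z + - x) ≡ 1
    full-diag e = ∑≡n⇒ _ (λ x → 𝟙≤1 (mem? S (x , _))) e

  clash : ∀ {n a} {A : Set a} → n ≡ 0 → n ≡ 1 → A
  clash refl ()

  module _ {S : Subset} (normal : NormalPosition S) where
    open NormalPosition normal

    exchange-mod : ∀ x y u v → φ (col S u) + (φ (row S v) + φ (diag S (u + v))) ≡ φ (col S x) +
        (φ (row S y) + φ (diag S (x + y)))
    exchange-mod x y u v = trans (sym (mod (χ S (x , y)) u v))
        (trans (cong φ (exchange S equidistributed x y u v)) (mod (χ S (u , v)) x y))
      where
      open ≡-Reasoning
      mod : ∀ c x y → φ (p ℕ.* c ℕ.+ (col S x ℕ.+ (row S y ℕ.+ diag S (x + y)))) ≡ φ (col S x) +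
          (φ (row S y) + φ (diag S (x + y)))
      mod c x y = begin
        _ ≡⟨ φ-+ (p ℕ.* c) _ ⟩
        φ (p ℕ.* c) + φ (col S x ℕ.+ (row S y ℕ.+ diag S (x + y)))
          ≡⟨ cong₂ _+_ (trans (φ-* p c) (trans (cong (_* φ c) φ-p) (*-zeroˡ (φ c))))
               (trans (φ-+ (col S x) _) (cong (φ (col S x) +_) (φ-+ (row S y) _))) ⟩
        0# + (φ (col S x) + (φ (row S y) + φ (diag S (x + y)))) ≡⟨ +-identityˡ _ ⟩
        φ (col S x) + (φ (row S y) + φ (diag S (x + y))) ∎

    col-nonconstant : ∃ λ x → ∃ λ x′ → col S x ≢ col S x′
    col-nonconstant = nonconstant (col S) λ const → vertical-special λ { (x , y) (x′ , y′) →
      trans (size-vertical S x y) (trans (const x x′) (sym (size-vertical S x′ y′))) }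

    row-nonconstant : ∃ λ y → ∃ λ y′ → row S y ≢ row S y′
    row-nonconstant = nonconstant (row S) λ const → horizontal-special λ { (x , y) (x′ , y′) →
      trans (size-horizontal S x y) (trans (const y y′) (sym (size-horizontal S x′ y′))) }

    CommonSlope : 𝔽 → Set
    CommonSlope α = (∀ x → φ (col S x) ≡ α * x + φ (col S 0#)) × (∀ y → φ (row S y) ≡ α * y + φ (row S 0#))

    -- With slope 0 all column counts would be congruent but not all equal, which leaves only 0 and
    -- p, both attained; likewise for the rows. But an empty column and a full row would cross.
    common-slope : ∃ λ α → α ≢ 0# × CommonSlope α
    common-slope = nonzero (Pexider (φ ∘ col S) (φ ∘ row S) (φ ∘ diag S) exchange-mod)
      where
      nonzero : ∃ CommonSlope → ∃ λ α → α ≢ 0# × CommonSlope α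
      nonzero (α , fα , gα) = α , α≢0 , fα , gα
        where
        empty-col-exists : α ≡ 0# → ∃ λ x → col S x ≡ 0
        empty-col-exists α≡0 with col-nonconstant
        ... | x , x′ , ≢ with φ-injective-≤ (col≤p S x) (col≤p S x′)
            (zero-slope⇒constant (φ ∘ col S) α≡0 fα x x′) ≢
        ... | inj₁ (e , _) = x , e
        ... | inj₂ (_ , e) = x′ , e
        full-row-exists : α ≡ 0# → ∃ λ y → row S y ≡ p
        full-row-exists α≡0 with row-nonconstant
        ... | y , y′ , ≢ with φ-injective-≤ (row≤p S y) (row≤p S y′)
            (zero-slope⇒constant (φ ∘ row S) α≡0 gα y y′) ≢
        ... | inj₁ (_ , e) = y′ , e
        ... | inj₂ (e , _) = y , e
        α≢0 : α ≢ 0#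
        α≢0 α≡0 with empty-col-exists α≡0 | full-row-exists α≡0
        ... | x , ex | y , ey = clash (empty-col S ex y) (full-row S ey x)

    -- No line that crosses the empty column is full, so row and diagonal counts are below p. The
    -- row at the root of its affine function is then empty, so no column is full either, and both
    -- kinds of count equal the least residues of their affine functions.
    empty-col⇒threshold : ∀ {x₀} → col S x₀ ≡ 0 → Homothetic S threshold
    empty-col⇒threshold {x₀} e₀ = result common-slope
      where
      result : (∃ λ α → α ≢ 0# × CommonSlope α) → Homothetic S threshold
      result (α , α≢0 , fα , gα) = α , α≢0 , φ (col S 0#) , φ (row S 0#) , λ x y → mk⇔
        (λ xy∈S → subst (p ℕ.≤_) (col+row x y) (member⇒ (𝟙-yes (mem? S (x , y)) xy∈S)))
        (λ p≤ → decidable-stable (mem? S (x , y)) λ xy∉S →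
          nonmember⇒ (𝟙-no (mem? S (x , y)) xy∉S) (subst (p ℕ.≤_) (sym (col+row x y)) p≤))
        where
        row<p : ∀ y → row S y ℕ.< p
        row<p y = ℕₚ.≤∧≢⇒< (row≤p S y) λ full → clash (empty-col S e₀ y) (full-row S full x₀)
        root : ∃ λ y → α * y + φ (row S 0#) ≡ 0#
        root = affine-surjective α≢0 (φ (row S 0#)) 0#
        y₀ : 𝔽
        y₀ = proj₁ root
        row-y₀ : row S y₀ ≡ 0
        row-y₀ = trans (sym (toℕ-φ-< (row<p y₀))) (trans (cong toℕ (trans (gα y₀) (proj₂ root))) toℕ-0#)
        col<p : ∀ x → col S x ℕ.< p
        col<p x = ℕₚ.≤∧≢⇒< (col≤p S x) λ full → clash (empty-row S row-y₀ x) (full-col S full y₀)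
        diag<p : ∀ z → diag S z ℕ.< p
        diag<p z = ℕₚ.≤∧≢⇒< (diag≤p S z) λ full → clash (empty-col S e₀ (z + - x₀)) (full-diag S full x₀)
        col+row : ∀ x y → col S x ℕ.+ row S y ≡ toℕ (α * x + φ (col S 0#)) ℕ.+ toℕ (α * y + φ (row S 0#))
        col+row x y = cong₂ ℕ._+_ (trans (sym (toℕ-φ-< (col<p x))) (cong toℕ (fα x)))
          (trans (sym (toℕ-φ-< (row<p y))) (cong toℕ (gα y)))
        -- The base point is the crossing of the empty column and the empty row, so three terms on
        -- its side vanish.
        exchange₀ : ∀ x y → p ℕ.* χ S (x , y) ℕ.+ diag S (x₀ + y₀) ≡ col S x ℕ.+ row S y ℕ.+ diag S (x + y)
        exchange₀ x y = begin
          p ℕ.* χ S (x , y) ℕ.+ diag S (x₀ + y₀)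
            ≡⟨ cong₂ (λ a b → p ℕ.* χ S (x , y) ℕ.+ (a ℕ.+ (b ℕ.+ diag S (x₀ + y₀)))) e₀ row-y₀ ⟨
          p ℕ.* χ S (x , y) ℕ.+ (col S x₀ ℕ.+ (row S y₀ ℕ.+ diag S (x₀ + y₀)))
            ≡⟨ exchange S equidistributed x y x₀ y₀ ⟩
          p ℕ.* χ S (x₀ , y₀) ℕ.+ (col S x ℕ.+ (row S y ℕ.+ diag S (x + y)))
            ≡⟨ cong (ℕ._+ (col S x ℕ.+ (row S y ℕ.+ diag S (x + y))))
                 (trans (cong (p ℕ.*_) (empty-col S e₀ y₀)) (ℕₚ.*-zeroʳ p)) ⟩
          col S x ℕ.+ (row S y ℕ.+ diag S (x + y))
            ≡⟨ ℕₚ.+-assoc (col S x) (row S y) _ ⟨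
          col S x ℕ.+ row S y ℕ.+ diag S (x + y) ∎
          where open ≡-Reasoning
        p-1<p : p ∸ 1 ℕ.< p
        p-1<p = ℕₚ.∸-monoʳ-< (ℕ.s≤s ℕ.z≤n) (ℕₚ.<⇒≤ 1<p)
        ≤p-1 : ∀ {m} → m ℕ.< p → m ℕ.≤ p ∸ 1
        ≤p-1 {m} m<p = ℕₚ.∸-monoˡ-≤ 1 m<p
        -- The column with p - 1 points meets the empty row outside S. There `exchange₀` bounds the
        -- base diagonal count from below by p - 1; being less than p, it equals p - 1.
        top : ∃ λ x → α * x + φ (col S 0#) ≡ φ (p ∸ 1)
        top = affine-surjective α≢0 (φ (col S 0#)) (φ (p ∸ 1))
        x₁ : 𝔽
        x₁ = proj₁ top
        col-x₁ : col S x₁ ≡ p ∸ 1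
        col-x₁ = trans (sym (toℕ-φ-< (col<p x₁)))
            (trans (cong toℕ (trans (fα x₁) (proj₂ top))) (toℕ-φ-< p-1<p))
        diag₀ : diag S (x₀ + y₀) ≡ p ∸ 1
        diag₀ = ℕₚ.≤-antisym (≤p-1 (diag<p (x₀ + y₀))) (begin
          p ∸ 1                                              ≡⟨ col-x₁ ⟨
          col S x₁
            ≤⟨ ℕₚ.≤-trans (ℕₚ.m≤m+n _ (row S y₀)) (ℕₚ.m≤m+n _ (diag S (x₁ + y₀))) ⟩
          col S x₁ ℕ.+ row S y₀ ℕ.+ diag S (x₁ + y₀)         ≡⟨ exchange₀ x₁ y₀ ⟨
          p ℕ.* χ S (x₁ , y₀) ℕ.+ diag S (x₀ + y₀)
            ≡⟨ cong (ℕ._+ diag S (x₀ + y₀)) (trans (cong (p ℕ.*_) (empty-row S row-y₀ x₁)) (ℕₚ.*-zeroʳ p)) ⟩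
          diag S (x₀ + y₀)                                   ∎)
          where open ℕₚ.≤-Reasoning
        -- For a member, p + (p - 1) = A + B + C with C <= p - 1 gives A + B >= p. For a nonmember,
        -- p - 1 = A + B + C excludes it.
        member⇒ : ∀ {x y} → χ S (x , y) ≡ 1 → p ℕ.≤ col S x ℕ.+ row S y
        member⇒ {x} {y} e = ℕₚ.+-cancelʳ-≤ (p ∸ 1) p _ (begin
          p ℕ.+ (p ∸ 1)
            ≡⟨ cong₂ ℕ._+_ (trans (cong (p ℕ.*_) e) (ℕₚ.*-identityʳ p)) diag₀ ⟨
          p ℕ.* χ S (x , y) ℕ.+ diag S (x₀ + y₀)             ≡⟨ exchange₀ x y ⟩
          col S x ℕ.+ row S y ℕ.+ diag S (x + y)
            ≤⟨ ℕₚ.+-monoʳ-≤ (col S x ℕ.+ row S y) (≤p-1 (diag<p (x + y))) ⟩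
          col S x ℕ.+ row S y ℕ.+ (p ∸ 1)                    ∎)
          where open ℕₚ.≤-Reasoning
        nonmember⇒ : ∀ {x y} → χ S (x , y) ≡ 0 → ¬ (p ℕ.≤ col S x ℕ.+ row S y)
        nonmember⇒ {x} {y} e p≤ = ℕₚ.<-irrefl refl (begin-strict
          p ∸ 1                                              <⟨ p-1<p ⟩
          p                                                  ≤⟨ p≤ ⟩
          col S x ℕ.+ row S y                                ≤⟨ ℕₚ.m≤m+n _ _ ⟩
          col S x ℕ.+ row S y ℕ.+ diag S (x + y)             ≡⟨ exchange₀ x y ⟨
          p ℕ.* χ S (x , y) ℕ.+ diag S (x₀ + y₀)
            ≡⟨ cong₂ ℕ._+_ (trans (cong (p ℕ.*_) e) (ℕₚ.*-zeroʳ p)) diag₀ ⟩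
          p ∸ 1                                              ∎)
          where open ℕₚ.≤-Reasoning

    -- At the root of the affine function the column count is divisible by p, and it lies in
    -- [0 , p].
    extreme-col : ∃ λ x → col S x ≡ 0 ⊎ col S x ≡ p
    extreme-col = result common-slope
      where
      result : (∃ λ α → α ≢ 0# × CommonSlope α) → ∃ λ x → col S x ≡ 0 ⊎ col S x ≡ p
      result (α , α≢0 , fα , _) = x₀ , zero-or-p (col≤p S x₀) (trans (fα x₀) (proj₂ root))
        where
        root : ∃ λ x → α * x + φ (col S 0#) ≡ 0#
        root = affine-surjective α≢0 (φ (col S 0#)) 0#
        x₀ : 𝔽
        x₀ = proj₁ root
        zero-or-p : ∀ {n} → n ℕ.≤ p → φ n ≡ 0# → n ≡ 0 ⊎ n ≡ p
        zero-or-p n≤p e with ℕₚ.m≤n⇒m<n∨m≡n n≤p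
        ... | inj₁ n<p = inj₁ (trans (sym (toℕ-φ-< n<p)) (trans (cong toℕ e) toℕ-0#))
        ... | inj₂ n≡p = inj₂ n≡p

  -- Complements

  size-ᶜ-line : ∀ S q d → size (S ∩ line q d) ℕ.+ size (S ᶜ ∩ line q d) ≡ p
  size-ᶜ-line S q d = begin
    size (S ∩ line q d) ℕ.+ size (S ᶜ ∩ line q d)
      ≡⟨ cong₂ ℕ._+_ (size-∩-line S q d) (size-∩-line (S ᶜ) q d) ⟩
    ∑[ t < p ] χ S (q ⊕ t · proj₁ d) ℕ.+ ∑[ t < p ] χ (S ᶜ) (q ⊕ t · proj₁ d)
      ≡⟨ ∑-distrib-+ (λ t → χ S (q ⊕ t · proj₁ d)) (λ t → χ (S ᶜ) (q ⊕ t · proj₁ d)) ⟨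
    ∑[ t < p ] (χ S (q ⊕ t · proj₁ d) ℕ.+ χ (S ᶜ) (q ⊕ t · proj₁ d))
      ≡⟨ sum-cong-≗ (λ t → χ-ᶜ S (q ⊕ t · proj₁ d)) ⟩
    ∑[ t < p ] 1
      ≡⟨ trans (∑-const p 1) (ℕₚ.*-identityʳ p) ⟩
    p ∎
    where open ≡-Reasoning

  equidistributed-ᶜ : ∀ S d → Equidistributed S d → Equidistributed (S ᶜ) d
  equidistributed-ᶜ S d eq q r = ℕₚ.+-cancelˡ-≡ (size (S ∩ line q d)) _ _
    (trans (size-ᶜ-line S q d) (trans (sym (size-ᶜ-line S r d)) (cong (ℕ._+ _) (eq r q))))

  -- Membership in `S ᶜ ᶜ` is a double negation, so the converse is obtained by cancelling on the
  -- other side instead of complementing twice.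
  equidistributed-ᶜ⁻ : ∀ S d → Equidistributed (S ᶜ) d → Equidistributed S d
  equidistributed-ᶜ⁻ S d eq q r = ℕₚ.+-cancelʳ-≡ (size (S ᶜ ∩ line q d)) _ _
    (trans (size-ᶜ-line S q d) (trans (sym (size-ᶜ-line S r d)) (cong (size (S ∩ line r d) ℕ.+_) (eq r q))))

  normalPosition-ᶜ : ∀ {S} → NormalPosition S → NormalPosition (S ᶜ)
  normalPosition-ᶜ {S} normal = record
    { equidistributed    = λ m m≢0 m≢-1 → equidistributed-ᶜ S (slope m) (equidistributed m m≢0 m≢-1)
    ; vertical-special   = vertical-special ∘ equidistributed-ᶜ⁻ S vertical
    ; horizontal-special = horizontal-special ∘ equidistributed-ᶜ⁻ S (slope 0#)
    }
    where open NormalPosition normal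

  full-col⇒empty-colᶜ : ∀ S {x} → col S x ≡ p → col (S ᶜ) x ≡ 0
  full-col⇒empty-colᶜ S {x} full = ℕₚ.+-cancelˡ-≡ p _ _ (begin
    p ℕ.+ col (S ᶜ) x         ≡⟨ cong (ℕ._+ col (S ᶜ) x) full ⟨
    col S x ℕ.+ col (S ᶜ) x   ≡⟨ cong₂ ℕ._+_ (size-vertical S x 0#) (size-vertical (S ᶜ) x 0#) ⟨
    _                         ≡⟨ size-ᶜ-line S (x , 0#) vertical ⟩
    p                         ≡⟨ ℕₚ.+-identityʳ p ⟨
    p ℕ.+ 0                   ∎)
    where open ≡-Reasoning

  -- Affine equivalence

  ∘-affine : AffineMap → AffineMap → AffineMap
  ∘-affine (affine a b c d e f) (affine a′ b′ c′ d′ e′ f′) = affine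
    (a * a′ + b * c′) (a * b′ + b * d′) (c * a′ + d * c′) (c * b′ + d * d′)
    (a * e′ + b * f′ + e) (c * e′ + d * f′ + f)

  abstract
    apply-∘ : ∀ g h q → apply (∘-affine g h) q ≡ apply g (apply h q)
    apply-∘ (affine a b c d e f) (affine a′ b′ c′ d′ e′ f′) (x , y) =
      cong₂ _,_ (coordinate a b e) (coordinate c d f)
      where
      coordinate : ∀ a b e → (a * a′ + b * c′) * x + (a * b′ + b * d′) * y + (a * e′ + b * f′ + e)
        ≡ a * (a′ * x + b′ * y + e′) + b * (c′ * x + d′ * y + f′) + e
      coordinate a b e = solve 11 (λ a b e a′ b′ c′ d′ e′ f′ x y →
        (a :* a′ :+ b :* c′) :* x :+ (a :* b′ :+ b :* d′) :* y :+ (a :* e′ :+ b :* f′ :+ e)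
        := a :* (a′ :* x :+ b′ :* y :+ e′) :+ b :* (c′ :* x :+ d′ :* y :+ f′) :+ e)
        refl a b e a′ b′ c′ d′ e′ f′ x y

  _⟨$⟩_ : AGL → 𝔽² → 𝔽²
  g ⟨$⟩ q = apply (AGL.to g) q

  infixr 5 _⟨$⟩_

  _∘ᴳ_ : AGL → AGL → AGL
  g ∘ᴳ h = record
    { to      = ∘-affine (to g) (to h)
    ; from    = ∘-affine (from h) (from g)
    ; to∘from = λ q → trans (trans (apply-∘ (to g) (to h) _)
        (cong (apply (to g) ∘ apply (to h)) (apply-∘ (from h) (from g) q)))
        (trans (cong (apply (to g)) (to∘from h (apply (from g) q))) (to∘from g q))
    ; from∘to = λ q → trans (trans (apply-∘ (from h) (from g) _)
        (cong (apply (from h) ∘ apply (from g)) (apply-∘ (to g) (to h) q)))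
        (trans (cong (apply (from h)) (from∘to g (apply (to h) q))) (from∘to h q))
    }
    where open AGL

  _⁻¹ : AGL → AGL
  g ⁻¹ = record { to = AGL.from g ; from = AGL.to g ; to∘from = AGL.from∘to g ; from∘to = AGL.to∘from g }

  -- The inverse image form of transforming `T` to `S` by g. It composes as a chain of equivalences,
  -- without the existential in `_maps_onto_`.
  PullbackOf : Subset → Subset → Set
  PullbackOf S T = ∃ λ g → ∀ q → q ∈ T ⇔ (g ⟨$⟩ q) ∈ S

  pullback⇒transforms : ∀ {S T} → PullbackOf S T → T TransformsTo S
  pullback⇒transforms {S} (g , T⇔S) = g , λ y → mk⇔
    (λ y∈S → apply from y , Equivalence.from (T⇔S _) (subst (_∈ S) (sym (to∘from y)) y∈S) , to∘from y)
    (λ { (x , x∈T , refl) → Equivalence.to (T⇔S x) x∈T })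
    where open AGL g

  -- If g and h pull the same set back to T and U, then h⁻¹ ∘ g matches T with U. This gives
  -- uniqueness up to affine maps.
  pullback-unique : ∀ {S T U} → PullbackOf S T → PullbackOf S U → PullbackOf U T
  pullback-unique {S} (g , T⇔S) (h , U⇔S) = (h ⁻¹) ∘ᴳ g , λ q → mk⇔
    (λ q∈T → Equivalence.from (U⇔S _) (subst (_∈ S) (sym (h∘h⁻¹∘g q)) (Equivalence.to (T⇔S q) q∈T)))
    (λ hq∈U → Equivalence.from (T⇔S q) (subst (_∈ S) (h∘h⁻¹∘g q) (Equivalence.to (U⇔S _) hq∈U)))
    where
    h∘h⁻¹∘g : ∀ q → h ⟨$⟩ ((h ⁻¹) ∘ᴳ g) ⟨$⟩ q ≡ g ⟨$⟩ q
    h∘h⁻¹∘g q = trans (cong (h ⟨$⟩_) (apply-∘ (AGL.from h) (AGL.to g) q)) (AGL.to∘from h (g ⟨$⟩ q))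

  pullback-size : ∀ {S T} → PullbackOf S T → size T ≡ size S
  pullback-size {S} {T} (g , T⇔S) =
      length-filter-↣ (mem? T) (mem? S) points! points! ∈-points ∈-points (g ⟨$⟩_)
    (λ {q} {r} e → trans (sym (from∘to q)) (trans (cong (apply from) e) (from∘to r)))
    (λ q → Equivalence.to (T⇔S q))
    (λ q q∈S → apply from q , Equivalence.from (T⇔S _) (subst (_∈ S) (sym (to∘from q)) q∈S) , to∘from q)
    where open AGL g

  preimage : AGL → Subset → Subset
  preimage g T = record { mem = λ q → (g ⟨$⟩ q) ∈ T ; mem? = λ q → mem? T (g ⟨$⟩ q) }

  -- Determinants and proportional vectors

  det : 𝔽² → 𝔽² → 𝔽
  det (a , b) (c , d) = a * d + - (b * c)

  abstract
    -- The inverse is i times the adjugate, with i inverse to the determinant, and translates by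
    -- minus the image of (e , f) under it. The proof is abstract, so the coefficients of `AGL.to g`
    -- are exported as an equation.
    invertible : ∀ a b c d e f → det (a , c) (b , d) ≢ 0# → ∃ λ g → AGL.to g ≡ affine a b c d e f
    invertible a b c d e f det≢0 with inverse (a * d + - (c * b)) det≢0
    ... | i , iD≡1 = record
      { to      = affine a b c d e f
      ; from    = affine (i * d) (- (i * b)) (- (i * c)) (i * a) (i * (b * f + - (d * e)))
          (i * (c * e + - (a * f)))
      ; to∘from = λ { (x , y) → cong₂ _,_
          (to∘from x e (solve 9 (λ a b c d e f i x y →
            a :* (i :* d :* x :+ :- (i :* b) :* y :+ i :* (b :* f :+ :- (d :* e))) :+ b :*
                (:- (i :* c) :* x :+ i :* a :* y :+ i :* (c :* e :+ :- (a :* f))) :+ e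
            := (i :* (a :* d :+ :- (c :* b))) :* (x :+ :- e) :+ e) refl a b c d e f i x y))
          (to∘from y f (solve 9 (λ a b c d e f i x y →
            c :* (i :* d :* x :+ :- (i :* b) :* y :+ i :* (b :* f :+ :- (d :* e))) :+ d :*
                (:- (i :* c) :* x :+ i :* a :* y :+ i :* (c :* e :+ :- (a :* f))) :+ f
            := (i :* (a :* d :+ :- (c :* b))) :* (y :+ :- f) :+ f) refl a b c d e f i x y)) }
      ; from∘to = λ { (x , y) → cong₂ _,_
          (from∘to x (solve 9 (λ a b c d e f i x y →
            i :* d :* (a :* x :+ b :* y :+ e) :+ :- (i :* b) :* (c :* x :+ d :* y :+ f) :+ i :*
                (b :* f :+ :- (d :* e))
            := (i :* (a :* d :+ :- (c :* b))) :* x) refl a b c d e f i x y))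
          (from∘to y (solve 9 (λ a b c d e f i x y →
            :- (i :* c) :* (a :* x :+ b :* y :+ e) :+ i :* a :* (c :* x :+ d :* y :+ f) :+ i :*
                (c :* e :+ :- (a :* f))
            := (i :* (a :* d :+ :- (c :* b))) :* y) refl a b c d e f i x y)) }
      } , refl
      where
      from∘to : ∀ {l} x → l ≡ (i * (a * d + - (c * b))) * x → l ≡ x
      from∘to x e = trans e (trans (cong (_* x) iD≡1) (*-identityˡ x))
      to∘from : ∀ {l} x z → l ≡ (i * (a * d + - (c * b))) * (x + - z) + z → l ≡ x
      to∘from x z e = trans e (trans (cong (λ u → u * (x + - z) + z) iD≡1)
          (solve 2 (λ x z → :1 :* (x :+ :- z) :+ z := x) refl x z))

    -- The scalar cannot vanish because `e` is nonzero.
    multiple⇒∼ : ∀ (d e : Direction) c → proj₁ e ≡ c · proj₁ d → d ∼ e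
    multiple⇒∼ ((a , b) , _) (_ , e≢𝟎) c refl =
        c , (λ { refl → e≢𝟎 (cong₂ _,_ (*-zeroˡ a) (*-zeroˡ b)) }) , refl

    ∼-sym : ∀ (d e : Direction) → d ∼ e → e ∼ d
    ∼-sym d@((a , b) , _) e@(_ , _) (c , c≢0 , refl) with inverse c c≢0
    ... | i , ic≡1 = multiple⇒∼ e d i (cong₂ _,_ (coordinate a) (coordinate b))
      where
      coordinate : ∀ a → a ≡ i * (c * a)
      coordinate a = trans (sym (*-identityˡ a)) (trans (cong (_* a) (sym ic≡1)) (*-assoc i c a))

    ∼-trans : ∀ (d e f : Direction) → d ∼ e → e ∼ f → d ∼ f
    ∼-trans d@((a , b) , _) (_ , _) f@(_ , _) (c , _ , refl) (c′ , _ , refl) =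
      multiple⇒∼ d f (c′ * c) (cong₂ _,_ (sym (*-assoc c′ c a)) (sym (*-assoc c′ c b)))

    -- The scalar is the ratio of the entries at a coordinate where d does not vanish; the zero
    -- determinant makes it work at the other one too.
    det≡0⇒∼ : ∀ (d e : Direction) → det (proj₁ d) (proj₁ e) ≡ 0# → d ∼ e
    det≡0⇒∼ ((a , b) , ab≢𝟎) ((c , d) , cd≢𝟎) ad-bc≡0 with a ≟ᶠ 0# | b ≟ᶠ 0#
    ... | yes a≡0 | yes b≡0 = contradiction (cong₂ _,_ a≡0 b≡0) ab≢𝟎
    ... | no a≢0  | _       = ratio (inverse a a≢0)
      where
      ratio : (∃ λ i → i * a ≡ 1#) → ∃ λ k → k ≢ 0# × (c , d) ≡ k · (a , b)
      ratio (i , ia≡1) = multiple⇒∼ ((a , b) , ab≢𝟎) ((c , d) , cd≢𝟎) (i * c) (cong₂ _,_ c≡ d≡)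
        where
        c≡ : c ≡ i * c * a
        c≡ = trans (sym (*-identityˡ c))
            (trans (cong (_* c) (sym ia≡1)) (solve 3 (λ i a c → i :* a :* c := i :* c :* a) refl i a c))
        d≡ : d ≡ i * c * b
        d≡ = begin
          d                                ≡⟨ *-identityˡ d ⟨
          1# * d                           ≡⟨ cong (_* d) ia≡1 ⟨
          i * a * d
            ≡⟨ solve 5 (λ i a b c d → i :* a :* d := i :* (a :* d :+ :- (b :* c)) :+ i :* c :* b) refl i a b c
                 d ⟩
          i * (a * d + - (b * c)) + i * c * b   ≡⟨ cong (λ z → i * z + i * c * b) ad-bc≡0 ⟩
          i * 0# + i * c * b
            ≡⟨ solve 3 (λ i b c → i :* :0 :+ i :* c :* b := i :* c :* b) refl i b c ⟩
          i * c * b                        ∎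
          where open ≡-Reasoning
    ... | yes _ | no b≢0 = ratio (inverse b b≢0)
      where
      ratio : (∃ λ i → i * b ≡ 1#) → ∃ λ k → k ≢ 0# × (c , d) ≡ k · (a , b)
      ratio (i , ib≡1) = multiple⇒∼ ((a , b) , ab≢𝟎) ((c , d) , cd≢𝟎) (i * d) (cong₂ _,_ c≡ d≡)
        where
        d≡ : d ≡ i * d * b
        d≡ = trans (sym (*-identityˡ d))
            (trans (cong (_* d) (sym ib≡1)) (solve 3 (λ i a c → i :* a :* c := i :* c :* a) refl i b d))
        c≡ : c ≡ i * d * a
        c≡ = begin
          c                                ≡⟨ *-identityˡ c ⟨
          1# * c                           ≡⟨ cong (_* c) ib≡1 ⟨
          i * b * c
            ≡⟨ solve 5 (λ i a b c d → i :* b :* c := i :* d :* a :+ :- (i :* (a :* d :+ :- (b :* c)))) refl i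
                 a b c d ⟩
          i * d * a + - (i * (a * d + - (b * c)))   ≡⟨ cong (λ z → i * d * a + - (i * z)) ad-bc≡0 ⟩
          i * d * a + - (i * 0#)
            ≡⟨ solve 3 (λ i a d → i :* d :* a :+ :- (i :* :0) := i :* d :* a) refl i a d ⟩
          i * d * a                        ∎
          where open ≡-Reasoning

    ∼⇒det≡0 : ∀ (d e : Direction) → d ∼ e → det (proj₁ d) (proj₁ e) ≡ 0#
    ∼⇒det≡0 ((a , b) , _) (_ , _) (c , _ , refl) =
        solve 3 (λ a b c → a :* (c :* b) :+ :- (b :* (c :* a)) := :0) refl a b c

    -- Proportional vectors trace the same line; only the parameter is rescaled.
    equidistributed-resp-∼ : ∀ S d e → d ∼ e → Equidistributed S d → Equidistributed S e
    equidistributed-resp-∼ S d@((a , b) , _) e@(_ , _) (c , c≢0 , refl) eq q r =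
        trans (same-size q) (trans (eq q r) (sym (same-size r)))
      where
      same-size : ∀ q → size (S ∩ line q e) ≡ size (S ∩ line q d)
      same-size q = begin
        size (S ∩ line q e)                       ≡⟨ size-∩-line S q e ⟩
        ∑[ t < p ] χ S (q ⊕ t · c · (a , b))
          ≡⟨ sum-cong-≗ (λ t → cong (λ v → χ S (q ⊕ v)) (cong₂ _,_ (*-assoc t c a) (*-assoc t c b))) ⟨
        ∑[ t < p ] χ S (q ⊕ (t * c) · (a , b))    ≡⟨ ∑-dilate (λ t → χ S (q ⊕ t · (a , b))) c≢0 ⟩
        ∑[ t < p ] χ S (q ⊕ t · (a , b))          ≡⟨ size-∩-line S q d ⟨
        size (S ∩ line q d)                       ∎
        where open ≡-Reasoning

    special-resp-∼ : ∀ S d e → d ∼ e → Special S d → Special S e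
    special-resp-∼ S d e d∼e special-d = special-d ∘ equidistributed-resp-∼ S e d (∼-sym d e d∼e)

    equidistributed-stable : ∀ S d → ¬ Special S d → Equidistributed S d
    equidistributed-stable S d ¬special q r = decidable-stable (_ ℕ.≟ _) λ ≢ → ¬special λ eq → ≢ (eq q r)

    size-preimage-line : ∀ g S q d e → (∀ t → g ⟨$⟩ (q ⊕ t · proj₁ d) ≡ (g ⟨$⟩ q) ⊕ t · proj₁ e) →
      size (preimage g S ∩ line q d) ≡ size (S ∩ line (g ⟨$⟩ q) e)
    size-preimage-line g S q d e g-line = trans (size-∩-line (preimage g S) q d)
      (trans (sum-cong-≗ (λ t → cong (χ S) (g-line t))) (sym (size-∩-line S (g ⟨$⟩ q) e)))

  -- Reduction to normal position

  linearPart : AffineMap → 𝔽² → 𝔽²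
  linearPart (affine a b c d e f) (u , v) = a * u + b * v , c * u + d * v

  abstract
    apply-⊕· : ∀ g q t v → apply g (q ⊕ t · v) ≡ apply g q ⊕ t · linearPart g v
    apply-⊕· (affine a b c d e f) (x , y) t (u , v) = cong₂ _,_ (coordinate a b e) (coordinate c d f)
      where
      coordinate : ∀ a b e → a * (x + t * u) + b * (y + t * v) + e ≡ a * x + b * y + e + t * (a * u + b * v)
      coordinate a b e = solve 8 (λ a b e x y t u v → a :* (x :+ t :* u) :+ b :* (y :+ t :* v) :+ e
        := a :* x :+ b :* y :+ e :+ t :* (a :* u :+ b :* v)) refl a b e x y t u v

    -- Otherwise g would send the origin and its translate by the direction vector to the same
    -- point.
    linearPart-nonZero : ∀ g (d : Direction) → linearPart (AGL.to g) (proj₁ d) ≢ 𝟎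
    linearPart-nonZero g (v , v≢𝟎) e =
        v≢𝟎 (trans (sym (𝟎⊕1· v)) (trans (sym (from∘to (𝟎 ⊕ 1# · v)))
        (trans (cong (apply from) g-v≡g-0) (from∘to 𝟎))))
      where
      open AGL g
      open ≡-Reasoning
      𝟎⊕1· : ∀ v → 𝟎 ⊕ 1# · v ≡ v
      𝟎⊕1· (a , b) = cong₂ _,_ (solve 1 (λ a → :0 :+ :1 :* a := a) refl a)
          (solve 1 (λ a → :0 :+ :1 :* a := a) refl b)
      ⊕1·𝟎 : ∀ q → q ⊕ 1# · 𝟎 ≡ q
      ⊕1·𝟎 (x , y) = cong₂ _,_ (solve 1 (λ x → x :+ :1 :* :0 := x) refl x)
          (solve 1 (λ x → x :+ :1 :* :0 := x) refl y)
      g-v≡g-0 : apply to (𝟎 ⊕ 1# · v) ≡ apply to 𝟎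
      g-v≡g-0 = trans (apply-⊕· to 𝟎 1# v) (trans (cong (λ w → apply to 𝟎 ⊕ 1# · w) e) (⊕1·𝟎 _))

  image : AGL → Direction → Direction
  image g d = linearPart (AGL.to g) (proj₁ d) , linearPart-nonZero g d

  abstract
    preimage-equidistributed : ∀ g S d → Equidistributed S (image g d) → Equidistributed (preimage g S) d
    preimage-equidistributed g S d eq q r = trans (size-line q) (trans (eq _ _) (sym (size-line r)))
      where
      size-line : ∀ q → size (preimage g S ∩ line q d) ≡ size (S ∩ line (g ⟨$⟩ q) (image g d))
      size-line q = size-preimage-line g S q d (image g d) (λ t → apply-⊕· (AGL.to g) q t (proj₁ d))

    preimage-equidistributed⁻ : ∀ g S d → Equidistributed (preimage g S) d → Equidistributed S (image g d)
    preimage-equidistributed⁻ g S d eq q r = trans (sym (size-line q)) (trans (eq _ _) (size-line r))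
      where
      open AGL g
      size-line : ∀ q → size (preimage g S ∩ line (apply from q) d) ≡ size (S ∩ line q (image g d))
      size-line q = trans (size-preimage-line g S (apply from q) d (image g d)
          (λ t → apply-⊕· to (apply from q) t (proj₁ d)))
        (cong (λ q → size (S ∩ line q (image g d))) (to∘from q))

  pullback-preimage : ∀ {S T} g → PullbackOf S (preimage g T) → PullbackOf S T
  pullback-preimage {S} {T} g (h , T⇔S) = h ∘ᴳ (g ⁻¹) , λ q → mk⇔
    (λ q∈T → subst (_∈ S) (sym (apply-∘ (to h) (from g) q))
        (Equivalence.to (T⇔S _) (subst (_∈ T) (sym (to∘from g q)) q∈T)))
    (λ hq∈S → subst (_∈ T) (to∘from g q)
        (Equivalence.from (T⇔S _) (subst (_∈ S) (apply-∘ (to h) (from g) q) hq∈S)))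
    where open AGL

  pullback-ᶜ : ∀ {S T} → PullbackOf S (T ᶜ) → PullbackOf (S ᶜ) T
  pullback-ᶜ {S} {T} (g , Tᶜ⇔S) = g , λ q → mk⇔
    (λ q∈T gq∈S → Equivalence.from (Tᶜ⇔S q) gq∈S q∈T)
    (λ gq∉S → decidable-stable (mem? T q) (λ q∉T → gq∉S (Equivalence.to (Tᶜ⇔S q) q∉T)))

  abstract
    empty-col⇒pullback : ∀ {S} → NormalPosition S → ∀ {x} → col S x ≡ 0 → PullbackOf threshold S
    empty-col⇒pullback {S} normal e = result (empty-col⇒threshold normal e)
      where
      result : Homothetic S threshold → PullbackOf threshold S
      result (α , α≢0 , β , γ , S⇔) = g , λ { (x , y) → mk⇔
        (λ xy∈S → subst (_∈ threshold) (sym (g-apply x y)) (Equivalence.to (S⇔ x y) xy∈S))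
        (λ gxy∈ → Equivalence.from (S⇔ x y) (subst (_∈ threshold) (g-apply x y) gxy∈)) }
        where
        inv : ∃ λ g → AGL.to g ≡ affine α 0# 0# α β γ
        inv = invertible α 0# 0# α β γ (λ e →
            *-nonZero α≢0 α≢0 (trans (solve 1 (λ a → a :* a := a :* a :+ :- (:0 :* :0)) refl α) e))
        g : AGL
        g = proj₁ inv
        g-apply : ∀ x y → g ⟨$⟩ (x , y) ≡ (α * x + β , α * y + γ)
        g-apply x y = trans (cong (λ M → apply M (x , y)) (proj₂ inv)) (cong₂ _,_
          (solve 4 (λ a b x y → a :* x :+ :0 :* y :+ b := a :* x :+ b) refl α β x y)
          (solve 4 (λ a c x y → :0 :* x :+ a :* y :+ c := a :* y :+ c) refl α γ x y))

    normalPosition⇒pullback : ∀ {S} → NormalPosition S → PullbackOf threshold S ⊎ PullbackOf (threshold ᶜ) S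
    normalPosition⇒pullback {S} normal = result (extreme-col normal)
      where
      result : (∃ λ x → col S x ≡ 0 ⊎ col S x ≡ p) → PullbackOf threshold S ⊎ PullbackOf (threshold ᶜ) S
      result (x , inj₁ e) = inj₁ (empty-col⇒pullback normal e)
      result (x , inj₂ e) = inj₂ (pullback-ᶜ {S = threshold} {S}
          (empty-col⇒pullback (normalPosition-ᶜ normal) (full-col⇒empty-colᶜ S e)))

    -- In the basis λ v₁, μ v₂ chosen here, λ v₁ − μ v₂ is a multiple of v₃.
    three-special⇒pullback : ∀ T (d₁ d₂ d₃ : Direction) → ¬ d₁ ∼ d₂ → ¬ d₁ ∼ d₃ → ¬ d₃ ∼ d₂ → Special T d₁ →
        Special T d₂ →
      (∀ d → Special T d → d₁ ∼ d ⊎ d₂ ∼ d ⊎ d₃ ∼ d) → PullbackOf threshold T ⊎ PullbackOf (threshold ᶜ) T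
    three-special⇒pullback T d₁@(v₁@(a₁ , b₁) , _) d₂@(v₂@(a₂ , b₂) , _) d₃@(v₃@(a₃ , b₃) , _) d₁≁d₂ d₁≁d₃
        d₃≁d₂ special₁ special₂ cover =
      lift (normalPosition⇒pullback normalPosition)
      where
      -- Cramer's rule reads D₁₂ v₃ = D₃₂ v₁ + D₁₃ v₂. With l = D₃₂ and m = -D₁₃ the vector (1 , -1)
      -- is therefore sent to D₁₂ v₃.
      D₁₂ D₁₃ D₃₂ l m : 𝔽
      D₁₂ = det v₁ v₂
      D₁₃ = det v₁ v₃
      D₃₂ = det v₃ v₂
      l = D₃₂
      m = - D₁₃
      D₁₂≢0 : D₁₂ ≢ 0#
      D₁₂≢0 = d₁≁d₂ ∘ det≡0⇒∼ d₁ d₂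
      l≢0 : l ≢ 0#
      l≢0 = d₃≁d₂ ∘ det≡0⇒∼ d₃ d₂
      -0≡0 : - 0# ≡ 0#
      -0≡0 = solve 0 (:- :0 := :0) refl
      m≢0 : m ≢ 0#
      m≢0 e = d₁≁d₃ (det≡0⇒∼ d₁ d₃ (trans (solve 1 (λ d → d := :- (:- d)) refl D₁₃) (trans (cong -_ e) -0≡0)))
      M : AffineMap
      M = affine (l * a₁) (m * a₂) (l * b₁) (m * b₂) 0# 0#
      inv : ∃ λ g → AGL.to g ≡ M
      inv = invertible (l * a₁) (m * a₂) (l * b₁) (m * b₂) 0# 0# λ e → *-nonZero (*-nonZero l≢0 m≢0) D₁₂≢0
        (trans (solve 6 (λ l m a₁ b₁ a₂ b₂ → l :* m :* (a₁ :* b₂ :+ :- (b₁ :* a₂)) :=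
            l :* a₁ :* (m :* b₂) :+ :- (l :* b₁ :* (m :* a₂))) refl l m a₁ b₁ a₂ b₂) e)
      g : AGL
      g = proj₁ inv
      linearPart-g : ∀ u v → linearPart (AGL.to g) (u , v) ≡
          (l * u * a₁ + m * v * a₂ , l * u * b₁ + m * v * b₂)
      linearPart-g u v = trans (cong (λ M → linearPart M (u , v)) (proj₂ inv))
          (cong₂ _,_ (coordinate a₁ a₂) (coordinate b₁ b₂))
        where
        coordinate : ∀ a b → l * a * u + m * b * v ≡ l * u * a + m * v * b
        coordinate a b = solve 6 (λ l m a b u v → l :* a :* u :+ m :* b :* v := l :* u :* a :+ m :* v :* b)
            refl l m a b u v
      d₂∼ : d₂ ∼ image g vertical
      d₂∼ = multiple⇒∼ d₂ (image g vertical) m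
          (trans (linearPart-g 0# 1#) (cong₂ _,_ (coordinate a₁ a₂) (coordinate b₁ b₂)))
        where
        coordinate : ∀ a b → l * 0# * a + m * 1# * b ≡ m * b
        coordinate a b = solve 4 (λ l m a b → l :* :0 :* a :+ m :* :1 :* b := m :* b) refl l m a b
      d₁∼ : d₁ ∼ image g (slope 0#)
      d₁∼ = multiple⇒∼ d₁ (image g (slope 0#)) l
          (trans (linearPart-g 1# 0#) (cong₂ _,_ (coordinate a₁ a₂) (coordinate b₁ b₂)))
        where
        coordinate : ∀ a b → l * 1# * a + m * 0# * b ≡ l * a
        coordinate a b = solve 4 (λ l m a b → l :* :1 :* a :+ m :* :0 :* b := l :* a) refl l m a b
      det-image : ∀ k (v : 𝔽²) → det v (linearPart (AGL.to g) (1# , k)) ≡ l * det v v₁ + k * m * det v v₂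
      det-image k (a , b) = trans (cong (det (a , b)) (linearPart-g 1# k))
        (solve 9 (λ l m k a b a₁ b₁ a₂ b₂ →
            a :* (l :* :1 :* b₁ :+ m :* k :* b₂) :+ :- (b :* (l :* :1 :* a₁ :+ m :* k :* a₂))
          := l :* (a :* b₁ :+ :- (b :* a₁)) :+ k :* m :* (a :* b₂ :+ :- (b :* a₂))) refl l m k a b a₁ b₁ a₂
              b₂)
      normalPosition : NormalPosition (preimage g T)
      normalPosition = record
        { equidistributed    = λ k k≢0 k≢-1 →
            preimage-equidistributed g T (slope k)
            (equidistributed-stable T (image g (slope k))
            (not-special k k≢0 k≢-1 ∘ cover (image g (slope k))))
        ; vertical-special   = special-resp-∼ T d₂ (image g vertical) d₂∼ special₂ ∘ preimage-equidistributed⁻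
            g T vertical
        ; horizontal-special = special-resp-∼ T d₁ (image g (slope 0#)) d₁∼ special₁ ∘
            preimage-equidistributed⁻ g T (slope 0#)
        }
        where
        -- If the image of (1 , k) were proportional to v₁, v₂ or v₃, then k m D₁₂, l D₁₂ or l m (1
        -- + k) respectively would vanish, and none of them does.
        not-special : ∀ k → k ≢ 0# → k ≢ - 1# →
            ¬ (d₁ ∼ image g (slope k) ⊎ d₂ ∼ image g (slope k) ⊎ d₃ ∼ image g (slope k))
        not-special k k≢0 k≢-1 (inj₁ ∼) = *-nonZero (*-nonZero k≢0 m≢0) D₁₂≢0 (trans
          (solve 4 (λ l k m D → k :* m :* D := l :* :0 :+ k :* m :* D) refl l k m D₁₂)
          (trans (cong (λ z → l * z + k * m * D₁₂) (solve 2 (λ a b → :0 := a :* b :+ :- (b :* a)) refl a₁ b₁))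
            (trans (sym (det-image k v₁)) (∼⇒det≡0 d₁ (image g (slope k)) ∼))))
        not-special k k≢0 k≢-1 (inj₂ (inj₁ ∼)) = *-nonZero l≢0 D₁₂≢0 (trans
          (solve 7 (λ l k m a₁ b₁ a₂ b₂ → l :* (a₁ :* b₂ :+ :- (b₁ :* a₂)) :=
              :- (l :* (a₂ :* b₁ :+ :- (b₂ :* a₁)) :+ k :* m :* (a₂ :* b₂ :+ :- (b₂ :* a₂))))
            refl l k m a₁ b₁ a₂ b₂)
          (trans (cong -_ (trans (sym (det-image k v₂)) (∼⇒det≡0 d₂ (image g (slope k)) ∼))) -0≡0))
        not-special k k≢0 k≢-1 (inj₂ (inj₂ ∼)) = *-nonZero (*-nonZero l≢0 m≢0) 1+k≢0 (trans
          (solve 3 (λ l m k → l :* m :* (:1 :+ k) := l :* m :+ k :* m :* l) refl l m k)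
          (trans (cong (λ z → l * z + k * m * l)
              (solve 4 (λ a₁ b₁ a₃ b₃ → :- (a₁ :* b₃ :+ :- (b₁ :* a₃)) := a₃ :* b₁ :+ :- (b₃ :* a₁)) refl a₁
              b₁ a₃ b₃))
            (trans (sym (det-image k v₃)) (∼⇒det≡0 d₃ (image g (slope k)) ∼))))
          where
          1+k≢0 : 1# + k ≢ 0#
          1+k≢0 e = k≢-1 (+-cancelˡ 1# _ _ (trans e (sym (-‿inverseʳ 1#))))
      lift : PullbackOf threshold (preimage g T) ⊎ PullbackOf (threshold ᶜ) (preimage g T) →
          PullbackOf threshold T ⊎ PullbackOf (threshold ᶜ) T
      lift (inj₁ q) = inj₁ (pullback-preimage {threshold} {T} g q)
      lift (inj₂ q) = inj₂ (pullback-preimage {threshold ᶜ} {T} g q)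

  -- The extremal set

  σ : ℕ
  σ = ∑[ x < p ] toℕ x

  abstract
    -- The membership indicator of threshold is the carry of x + y.
    threshold-carry : ∀ x y → p ℕ.* χ threshold (x , y) ℕ.+ toℕ (x + y) ≡ toℕ x ℕ.+ toℕ y
    threshold-carry x y = carry (p ℕ.≤? s)
      where
      open ≡-Reasoning
      s : ℕ
      s = toℕ x ℕ.+ toℕ y
      carry : (p≤s? : Dec (p ℕ.≤ s)) → p ℕ.* 𝟙 p≤s? ℕ.+ toℕ (φ s) ≡ s
      carry (no p≰s)  = trans (cong (ℕ._+ toℕ (φ s)) (ℕₚ.*-zeroʳ p)) (toℕ-φ-< (ℕₚ.≰⇒> p≰s))
      carry (yes p≤s) = begin
        p ℕ.* 1 ℕ.+ toℕ (φ s)    ≡⟨ cong₂ ℕ._+_ (ℕₚ.*-identityʳ p) (trans (cong toℕ φs≡) (toℕ-φ-< s∸p<p)) ⟩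
        p ℕ.+ (s ∸ p)            ≡⟨ ℕₚ.m+[n∸m]≡n p≤s ⟩
        s                        ∎
        where
        φs≡ : φ s ≡ φ (s ∸ p)
        φs≡ = trans (cong φ (sym (ℕₚ.m+[n∸m]≡n p≤s))) (trans (φ-+ p (s ∸ p))
          (trans (cong (_+ φ (s ∸ p)) φ-p) (+-identityˡ (φ (s ∸ p)))))
        s∸p<p : s ∸ p ℕ.< p
        s∸p<p = ℕₚ.+-cancelˡ-< p _ _ (subst (ℕ._< p ℕ.+ p) (sym (ℕₚ.m+[n∸m]≡n p≤s))
            (ℕₚ.+-mono-< (toℕ<n x) (toℕ<n y)))

    -- The carry identity summed along a curve: counting points becomes adding residues, and a
    -- residue that runs through all of 𝔽 contributes `σ`.
    ∑-threshold : ∀ (f g : 𝔽 → 𝔽) → p ℕ.* ∑[ t < p ] χ threshold (f t , g t) ℕ.+ ∑[ t < p ] toℕ (f t + g t)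
      ≡ ∑[ t < p ] toℕ (f t) ℕ.+ ∑[ t < p ] toℕ (g t)
    ∑-threshold f g = begin
      p ℕ.* ∑[ t < p ] χ threshold (f t , g t) ℕ.+ ∑[ t < p ] toℕ (f t + g t)
        ≡⟨ cong (ℕ._+ ∑[ t < p ] toℕ (f t + g t)) (*-distribˡ-sum p (λ t → χ threshold (f t , g t))) ⟩
      ∑[ t < p ] (p ℕ.* χ threshold (f t , g t)) ℕ.+ ∑[ t < p ] toℕ (f t + g t)
        ≡⟨ ∑-distrib-+ (λ t → p ℕ.* χ threshold (f t , g t)) (λ t → toℕ (f t + g t)) ⟨
      ∑[ t < p ] (p ℕ.* χ threshold (f t , g t) ℕ.+ toℕ (f t + g t))
        ≡⟨ sum-cong-≗ (λ t → threshold-carry (f t) (g t)) ⟩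
      ∑[ t < p ] (toℕ (f t) ℕ.+ toℕ (g t))
        ≡⟨ ∑-distrib-+ (toℕ ∘ f) (toℕ ∘ g) ⟩
      ∑[ t < p ] toℕ (f t) ℕ.+ ∑[ t < p ] toℕ (g t) ∎
      where open ≡-Reasoning

    col-threshold : ∀ x → col threshold x ≡ toℕ x
    col-threshold x = ℕₚ.*-cancelˡ-≡ _ _ p (ℕₚ.+-cancelʳ-≡ σ _ _ (begin
      p ℕ.* col threshold x ℕ.+ σ
        ≡⟨ cong (p ℕ.* col threshold x ℕ.+_) (∑-translate toℕ x) ⟨
      p ℕ.* col threshold x ℕ.+ ∑[ y < p ] toℕ (x + y)
        ≡⟨ ∑-threshold (λ _ → x) id ⟩
      ∑[ y < p ] toℕ x ℕ.+ σ
        ≡⟨ cong (ℕ._+ σ) (∑-const p (toℕ x)) ⟩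
      p ℕ.* toℕ x ℕ.+ σ ∎))
      where open ≡-Reasoning

    row-threshold : ∀ y → row threshold y ≡ toℕ y
    row-threshold y = trans (sum-cong-≗ {p} χ-comm) (col-threshold y)
      where
      χ-comm : ∀ x → χ threshold (x , y) ≡ χ threshold (y , x)
      χ-comm x = cong (λ s → 𝟙 (p ℕ.≤? s)) (ℕₚ.+-comm (toℕ x) (toℕ y))

    -- Here the coordinate sum is constantly z, while each coordinate permutes 𝔽. So the count
    -- decreases as z grows.
    diag-threshold : ∀ z → p ℕ.* diag threshold z ℕ.+ p ℕ.* toℕ z ≡ σ ℕ.+ σ
    diag-threshold z = begin
      p ℕ.* diag threshold z ℕ.+ p ℕ.* toℕ z
        ≡⟨ cong (p ℕ.* diag threshold z ℕ.+_) (∑-const p (toℕ z)) ⟨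
      p ℕ.* diag threshold z ℕ.+ ∑[ x < p ] toℕ z
        ≡⟨ cong (p ℕ.* diag threshold z ℕ.+_)
             (sum-cong-≗ (λ x → cong toℕ (solve 2 (λ x z → z := x :+ (z :+ :- x)) refl x z))) ⟩
      p ℕ.* diag threshold z ℕ.+ ∑[ x < p ] toℕ (x + (z + - x))
        ≡⟨ ∑-threshold id (λ x → z + - x) ⟩
      σ ℕ.+ ∑[ x < p ] toℕ (z + - x)
        ≡⟨ cong (σ ℕ.+_) (∑-reindex toℕ (λ x → z + - x) (λ x → z + - x) involution involution) ⟩
      σ ℕ.+ σ ∎
      where
      open ≡-Reasoning
      involution : ∀ x → z + - (z + - x) ≡ x
      involution = solve 2 (λ z x → z :+ :- (z :+ :- x) := x) refl z

    toℕ0≢toℕ1 : toℕ 0# ≢ toℕ 1#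
    toℕ0≢toℕ1 e = 1≢0 (sym (toℕ-injective e))

    vertical-special : Special threshold vertical
    vertical-special eq = toℕ0≢toℕ1 (begin
      toℕ 0#                                             ≡⟨ col-threshold 0# ⟨
      col threshold 0#                                   ≡⟨ size-vertical threshold 0# 0# ⟨
      size (threshold ∩ line (0# , 0#) vertical)         ≡⟨ eq (0# , 0#) (1# , 0#) ⟩
      size (threshold ∩ line (1# , 0#) vertical)         ≡⟨ size-vertical threshold 1# 0# ⟩
      col threshold 1#                                   ≡⟨ col-threshold 1# ⟩
      toℕ 1#                                             ∎)
      where open ≡-Reasoning

    horizontal-special : Special threshold (slope 0#)
    horizontal-special eq = toℕ0≢toℕ1 (begin
      toℕ 0#                                             ≡⟨ row-threshold 0# ⟨
      row threshold 0#                                   ≡⟨ size-horizontal threshold 0# 0# ⟨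
      size (threshold ∩ line (0# , 0#) (slope 0#))       ≡⟨ eq (0# , 0#) (0# , 1#) ⟩
      size (threshold ∩ line (0# , 1#) (slope 0#))       ≡⟨ size-horizontal threshold 0# 1# ⟩
      row threshold 1#                                   ≡⟨ row-threshold 1# ⟩
      toℕ 1#                                             ∎)
      where open ≡-Reasoning

    diagonal-special : Special threshold (slope (- 1#))
    diagonal-special eq = toℕ0≢toℕ1 (ℕₚ.*-cancelˡ-≡ _ _ p (ℕₚ.+-cancelˡ-≡ (p ℕ.* diag threshold 0#) _ _ (begin
      p ℕ.* diag threshold 0# ℕ.+ p ℕ.* toℕ 0#    ≡⟨ diag-threshold 0# ⟩
      σ ℕ.+ σ                                     ≡⟨ diag-threshold 1# ⟨
      p ℕ.* diag threshold 1# ℕ.+ p ℕ.* toℕ 1#    ≡⟨ cong (λ n → p ℕ.* n ℕ.+ p ℕ.* toℕ 1#) diag₁≡diag₀ ⟩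
      p ℕ.* diag threshold 0# ℕ.+ p ℕ.* toℕ 1#    ∎)))
      where
      open ≡-Reasoning
      diag₁≡diag₀ : diag threshold 1# ≡ diag threshold 0#
      diag₁≡diag₀ = begin
        diag threshold 1#                                     ≡⟨ cong (diag threshold) (+-identityʳ 1#) ⟨
        diag threshold (1# + 0#)                              ≡⟨ size-diagonal threshold 1# 0# ⟨
        size (threshold ∩ line (1# , 0#) (slope (- 1#)))      ≡⟨ eq (1# , 0#) (0# , 0#) ⟩
        size (threshold ∩ line (0# , 0#) (slope (- 1#)))      ≡⟨ size-diagonal threshold 0# 0# ⟩
        diag threshold (0# + 0#)                              ≡⟨ cong (diag threshold) (+-identityʳ 0#) ⟩
        diag threshold 0#                                     ∎

    -- Both coordinates and their sum run through 𝔽 along the line, so p times the count is `σ`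
    -- wherever the line lies.
    generic-equidistributed : ∀ u v (uv≢𝟎 : (u , v) ≢ 𝟎) → u ≢ 0# → v ≢ 0# → u + v ≢ 0# →
        Equidistributed threshold ((u , v) , uv≢𝟎)
    generic-equidistributed u v uv≢𝟎 u≢0 v≢0 u+v≢0 q r =
        ℕₚ.*-cancelˡ-≡ _ _ p (ℕₚ.+-cancelʳ-≡ σ _ _ (trans (line-sum q) (sym (line-sum r))))
      where
      open ≡-Reasoning
      d : Direction
      d = (u , v) , uv≢𝟎
      line-sum : ∀ q → p ℕ.* size (threshold ∩ line q d) ℕ.+ σ ≡ σ ℕ.+ σ
      line-sum (x , y) = begin
        p ℕ.* size (threshold ∩ line (x , y) d) ℕ.+ σ
          ≡⟨ cong₂ (λ n s → p ℕ.* n ℕ.+ s) (sym (size-∩-line threshold (x , y) d)) (trans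
               (sum-cong-≗ (λ t → cong toℕ (solve 5
                   (λ x y t u v → x :+ t :* u :+ (y :+ t :* v) := (x :+ y) :+ t :* (u :+ v)) refl x y t u v)))
               (∑-affine toℕ (x + y) u+v≢0)) ⟨
        p ℕ.* ∑[ t < p ] χ threshold (x + t * u , y + t * v) ℕ.+ ∑[ t < p ] toℕ (x + t * u + (y + t * v))
          ≡⟨ ∑-threshold (λ t → x + t * u) (λ t → y + t * v) ⟩
        ∑[ t < p ] toℕ (x + t * u) ℕ.+ ∑[ t < p ] toℕ (y + t * v)
          ≡⟨ cong₂ ℕ._+_ (∑-affine toℕ x u≢0) (∑-affine toℕ y v≢0) ⟩
        σ ℕ.+ σ ∎

    size-threshold : size threshold ≡ σ
    size-threshold = trans (size-∑ threshold) (sum-cong-≗ col-threshold)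

    2*size-threshold : 2 ℕ.* size threshold ≡ p ℕ.* (p ∸ 1)
    2*size-threshold = trans (cong (2 ℕ.*_) size-threshold) (∑-toℕ p)

    size-threshold-half : size threshold ≡ p ℕ.* (p ∸ 1) / 2
    size-threshold-half = begin
      size threshold               ≡⟨ m*n/n≡m (size threshold) 2 ⟨
      size threshold ℕ.* 2 / 2     ≡⟨ cong (_/ 2) (trans (ℕₚ.*-comm (size threshold) 2) 2*size-threshold) ⟩
      p ℕ.* (p ∸ 1) / 2            ∎
      where open ≡-Reasoning

    size-+-ᶜ : ∀ S → size S ℕ.+ size (S ᶜ) ≡ p ℕ.* p
    size-+-ᶜ S = begin
      size S ℕ.+ size (S ᶜ)
        ≡⟨ cong₂ ℕ._+_ (size-∑ S) (size-∑ (S ᶜ)) ⟩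
      ∑[ x < p ] col S x ℕ.+ ∑[ x < p ] col (S ᶜ) x
        ≡⟨ ∑-distrib-+ (col S) (col (S ᶜ)) ⟨
      ∑[ x < p ] (col S x ℕ.+ col (S ᶜ) x)                                     ≡⟨ sum-cong-≗ (λ x → trans
        (sym (cong₂ ℕ._+_ (size-vertical S x 0#) (size-vertical (S ᶜ) x 0#)))
            (size-ᶜ-line S (x , 0#) vertical)) ⟩
      ∑[ x < p ] p                                                             ≡⟨ ∑-const p p ⟩
      p ℕ.* p                                                                  ∎
      where open ≡-Reasoning

    -- Equality would give p (p - 1) = 2 `size threshold` = p².
    size-threshold≢size-thresholdᶜ : size threshold ≢ size (threshold ᶜ)
    size-threshold≢size-thresholdᶜ e = ℕₚ.<-irrefl p-1≡p (ℕₚ.∸-monoʳ-< (ℕ.s≤s ℕ.z≤n) (ℕₚ.<⇒≤ 1<p))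
      where
      open ≡-Reasoning
      p-1≡p : p ∸ 1 ≡ p
      p-1≡p = ℕₚ.*-cancelˡ-≡ _ _ p (begin
        p ℕ.* (p ∸ 1)                              ≡⟨ 2*size-threshold ⟨
        size threshold ℕ.+ (size threshold ℕ.+ 0)
          ≡⟨ cong (size threshold ℕ.+_) (trans (ℕₚ.+-identityʳ _) e) ⟩
        size threshold ℕ.+ size (threshold ᶜ)      ≡⟨ size-+-ᶜ threshold ⟩
        p ℕ.* p                                    ∎)

  -- Counting directions

  representative : Fin (suc p) → Direction
  representative zero    = vertical
  representative (suc m) = slope m

  abstract
    representative-injective : ∀ i j → representative i ∼ representative j → i ≡ j
    representative-injective zero    zero    _ = refl
    representative-injective zero    (suc m) (c , _ , e) = contradiction (trans (cong proj₁ e) (zeroʳ c)) 1≢0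
    representative-injective (suc m) zero    (c , c≢0 , e) =
        contradiction (trans (sym (*-identityʳ c)) (sym (cong proj₁ e))) c≢0
    representative-injective (suc m) (suc n) (c , _ , e) = cong suc (sym (begin
      n         ≡⟨ cong proj₂ e ⟩
      c * m     ≡⟨ cong (_* m) (trans (sym (*-identityʳ c)) (sym (cong proj₁ e))) ⟩
      1# * m    ≡⟨ *-identityˡ m ⟩
      m         ∎))
      where open ≡-Reasoning

    represent : ∀ d → ∃ λ i → representative i ∼ d
    represent d@((u , v) , uv≢𝟎) with u ≟ᶠ 0#
    ... | yes u≡0 = zero , multiple⇒∼ vertical d v
        (cong₂ _,_ (trans u≡0 (sym (zeroʳ v))) (sym (*-identityʳ v)))
    ... | no u≢0 with inverse u u≢0
    ...   | i , iu≡1 = suc (i * v) , multiple⇒∼ (slope (i * v)) d u (cong₂ _,_ (sym (*-identityʳ u)) (begin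
      v              ≡⟨ *-identityˡ v ⟨
      1# * v         ≡⟨ cong (_* v) iu≡1 ⟨
      i * u * v      ≡⟨ solve 3 (λ i u v → i :* u :* v := u :* (i :* v)) refl i u v ⟩
      u * (i * v)    ∎))
      where open ≡-Reasoning

    represent⁻ : ∀ d → d ∼ representative (proj₁ (represent d))
    represent⁻ d = ∼-sym (representative (proj₁ (represent d))) d (proj₂ (represent d))

  module _ {P : Pred Direction 0ℓ} (P? : Decidable P) where

    representatives : List (Fin (suc p))
    representatives = filter (P? ∘ representative) (allFin (suc p))

    abstract
      -- Sending each enumerated direction to its representative is a bijection onto the
      -- representatives that satisfy P. The index set is filtered by the trivial predicate only to
      -- give both counts the same form.
      exactly⇒length : (∀ d e → d ∼ e → P d → P e) → ∀ {k} → Exactly k P → length representatives ≡ k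
      exactly⇒length P-resp {k} (f , f-injective , f-surjective) = begin
        length representatives
          ≡⟨ length-filter-↣ U? (P? ∘ representative) (Uniqueₚ.allFin⁺ k) (Uniqueₚ.allFin⁺ (suc p)) ∈-allFin
               ∈-allFin
          rep (λ {i} {j} → rep-injective i j)
              (λ i _ → P-resp (dir i) (representative (rep i)) (represent⁻ (dir i)) (proj₂ (f i)))
          (λ r Pr → rep-surjective r (f-surjective (representative r , Pr))) ⟨
        length (filter U? (allFin k))
          ≡⟨ cong length (filter-all U? {allFin k} (All.tabulate (λ _ → tt))) ⟩
        length (allFin k)                    ≡⟨ length-tabulate id ⟩
        k                                    ∎
        where
        open ≡-Reasoning
        dir : Fin k → Direction
        dir i = proj₁ (f i)
        rep : Fin k → Fin (suc p)
        rep i = proj₁ (represent (dir i))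
        rep-injective : ∀ i j → rep i ≡ rep j → i ≡ j
        rep-injective i j e = f-injective
            (∼-trans (dir i) (representative (rep i)) (dir j) (represent⁻ (dir i))
          (subst (λ r → representative r ∼ dir j) (sym e) (proj₂ (represent (dir j)))))
        rep-surjective : ∀ r → (∃ λ i → ∀ {z} → z ≡ i → dir z ∼ representative r) → ∃ λ i → U i × rep i ≡ r
        rep-surjective r (i , dir∼r) = i , tt , representative-injective (rep i) r
          (∼-trans (representative (rep i)) (dir i) (representative r) (proj₂ (represent (dir i)))
              (dir∼r refl))

      -- The filtered list is itself an enumeration, read off by `lookup`.
      exactly-length : (∀ d e → d ∼ e → P d → P e) → Exactly (length representatives) P
      exactly-length P-resp = f , (λ {i} {j} → f-injective {i} {j}) , f-surjective
        where
        r : Fin (length representatives) → Fin (suc p)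
        r = lookup representatives
        f : Fin (length representatives) → ∃ P
        f i = representative (r i) , proj₂
            (∈-filter⁻ (P? ∘ representative) {xs = allFin (suc p)} (∈-lookup {xs = representatives} i))
        f-injective : ∀ {i j} → representative (r i) ∼ representative (r j) → i ≡ j
        f-injective {i} {j} e = lookup-injective
            (Uniqueₚ.filter⁺ (P? ∘ representative) (Uniqueₚ.allFin⁺ (suc p)))
            (representative-injective (r i) (r j) e)
        f-surjective : ∀ (y : ∃ P) → ∃ λ i → ∀ {z} → z ≡ i → representative (r z) ∼ proj₁ y
        f-surjective (d , Pd) = index s∈ ,
            λ { refl → subst (λ s → representative s ∼ d) (lookup-index s∈) (proj₂ (represent d)) }
          where
          s : Fin (suc p)
          s = proj₁ (represent d)
          s∈ : s Mem.∈ representatives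
          s∈ = ∈-filter⁺ (P? ∘ representative) (∈-allFin s) (P-resp d (representative s) (represent⁻ d) Pd)

  -- Both predicates select from the same p + 1 representatives. It translates between 3 special and
  -- p - 2 equidistributed directions.
  exactly-complement : ∀ {P Q : Pred Direction 0ℓ} (P? : Decidable P) (Q? : Decidable Q) →
    (∀ d e → d ∼ e → P d → P e) → (∀ d e → d ∼ e → Q d → Q e) →
    (∀ {d} → P d → ¬ Q d) → (∀ {d} → ¬ P d → Q d) → ∀ {k} → Exactly k P → Exactly (suc p ∸ k) Q
  exactly-complement {P} {Q} P? Q? P-resp Q-resp P⇒¬Q ¬P⇒Q {k} exact =
      subst (λ n → Exactly n Q) length≡ (exactly-length Q? Q-resp)
    where
    open ≡-Reasoning
    length≡ : length (representatives Q?) ≡ suc p ∸ k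
    length≡ = begin
      length (representatives Q?)
        ≡⟨ ℕₚ.m+n∸m≡n (length (representatives P?)) _ ⟨
      length (representatives P?) ℕ.+ length (representatives Q?) ∸ length (representatives P?)
        ≡⟨ cong₂ _∸_ (trans (length-filter-complement (P? ∘ representative) (Q? ∘ representative) P⇒¬Q ¬P⇒Q
             (allFin (suc p))) (length-tabulate {n = suc p} id))
             (exactly⇒length P? P-resp exact) ⟩
      suc p ∸ k                                                       ∎

  equidistributed? : ∀ S → Decidable (Equidistributed S)
  equidistributed? S d = map′ (λ eq → λ { (x , y) (u , v) → eq x y u v }) (λ eq x y u v → eq (x , y) (u , v))
    (all? λ x → all? λ y → all? λ u → all? λ v → size (S ∩ line (x , y) d) ℕ.≟ size (S ∩ line (u , v) d))

  special? : ∀ S → Decidable (Special S)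
  special? S d = ¬? (equidistributed? S d)

  -- A direction (u , v) fails to be generic when u, v or u + v vanishes, and each of these
  -- conditions is one class of directions.
  threshold-special : Exactly 3 (Special threshold)
  threshold-special = f , (λ {i} {j} → f-injective i j) , f-surjective
    where
    r : Fin 3 → Fin (suc p)
    r zero             = zero
    r (suc zero)       = suc 0#
    r (suc (suc zero)) = suc (- 1#)
    f : Fin 3 → ∃ (Special threshold)
    f i = representative (r i) , special i
      where
      special : ∀ i → Special threshold (representative (r i))
      special zero             = vertical-special
      special (suc zero)       = horizontal-special
      special (suc (suc zero)) = diagonal-special
    r-injective : ∀ i j → r i ≡ r j → i ≡ j
    r-injective zero             zero             _ = refl
    r-injective zero             (suc zero)       ()
    r-injective zero             (suc (suc zero)) ()
    r-injective (suc zero)       (suc zero)       _ = refl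
    r-injective (suc zero)       (suc (suc zero)) e = contradiction (suc-injective e) 0≢-1
    r-injective (suc (suc zero)) (suc zero)       e = contradiction (suc-injective (sym e)) 0≢-1
    r-injective (suc (suc zero)) (suc (suc zero)) _ = refl
    f-injective : ∀ i j → representative (r i) ∼ representative (r j) → i ≡ j
    f-injective i j e = r-injective i j (representative-injective (r i) (r j) e)
    covered : ∀ d → Special threshold d → ∃ λ i → representative (r i) ∼ d
    covered d@((u , v) , uv≢𝟎) special with u ≟ᶠ 0# | v ≟ᶠ 0# | (u + v) ≟ᶠ 0#
    ... | yes u≡0 | _ | _ = zero , multiple⇒∼ vertical d v
        (cong₂ _,_ (trans u≡0 (sym (zeroʳ v))) (sym (*-identityʳ v)))
    ... | no _ | yes v≡0 | _ = suc zero , multiple⇒∼ (slope 0#) d u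
        (cong₂ _,_ (sym (*-identityʳ u)) (trans v≡0 (sym (zeroʳ u))))
    ... | no _ | no _ | yes u+v≡0 =
        suc (suc zero) , multiple⇒∼ (slope (- 1#)) d u (cong₂ _,_ (sym (*-identityʳ u))
      (trans (solve 2 (λ u v → v := :- u :+ (u :+ v)) refl u v)
          (trans (cong (- u +_) u+v≡0) (solve 1 (λ u → :- u :+ :0 := u :* :- :1) refl u))))
    ... | no u≢0 | no v≢0 | no u+v≢0 = contradiction (generic-equidistributed u v uv≢𝟎 u≢0 v≢0 u+v≢0) special
    f-surjective : ∀ (y : ∃ (Special threshold)) → ∃ λ i → ∀ {z} → z ≡ i → representative (r z) ∼ proj₁ y
    f-surjective (d , special) = proj₁ (covered d special) , λ { refl → proj₂ (covered d special) }

  -- Extremal sets and sets with three special directions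

  Extremal : Subset → Set
  Extremal S = size S ≡ p ℕ.* (p ∸ 1) / 2 × Exactly (p ∸ 2) (Equidistributed S)

  threshold-extremal : Extremal threshold
  -- `suc p ∸ 3` computes to `p ∸ 2`.
  threshold-extremal = size-threshold-half , exactly-complement (special? threshold)
      (equidistributed? threshold)
    (special-resp-∼ threshold) (equidistributed-resp-∼ threshold) (λ special → special)
        (λ {d} → equidistributed-stable threshold d) threshold-special

  three-special⇒threshold : ∀ T → Exactly 3 (Special T) → PullbackOf threshold T ⊎ PullbackOf (threshold ᶜ) T
  three-special⇒threshold T (f , f-injective , f-surjective) =
      three-special⇒pullback T (d zero) (d (suc zero)) (d (suc (suc zero)))
    (λ e → contradiction (f-injective e) λ ()) (λ e → contradiction (f-injective e) λ ())
        (λ e → contradiction (f-injective e) λ ())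
    (proj₂ (f zero)) (proj₂ (f (suc zero))) λ e special → cover e (f-surjective (e , special))
    where
    d : Fin 3 → Direction
    d i = proj₁ (f i)
    cover : ∀ e → (∃ λ i → ∀ {z} → z ≡ i → d z ∼ e) → d zero ∼ e ⊎ d (suc zero) ∼ e ⊎ d (suc (suc zero)) ∼ e
    cover e (zero , ∼)             = inj₁ (∼ refl)
    cover e (suc zero , ∼)         = inj₂ (inj₁ (∼ refl))
    cover e (suc (suc zero) , ∼)   = inj₂ (inj₂ (∼ refl))

  -- Three special directions leave the model set or its complement; affine maps preserve size, and
  -- the two sizes differ.
  extremal⇒threshold : ∀ T → Extremal T → PullbackOf threshold T
  extremal⇒threshold T (size-T , exact) =
      result (three-special⇒threshold T (subst (λ k → Exactly k (Special T)) 1+p∸[p∸2]≡3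
    (exactly-complement (equidistributed? T) (special? T) (equidistributed-resp-∼ T) (special-resp-∼ T)
        (λ eq special → special eq) (λ ¬eq → ¬eq) exact)))
    where
    -- Truncated subtraction is exact here because `1<p` says 2 <= p.
    1+p∸[p∸2]≡3 : suc p ∸ (p ∸ 2) ≡ 3
    1+p∸[p∸2]≡3 = trans (ℕₚ.+-∸-assoc 1 (ℕₚ.m∸n≤m p 2)) (cong suc (ℕₚ.m∸[m∸n]≡n 1<p))
    result : PullbackOf threshold T ⊎ PullbackOf (threshold ᶜ) T → PullbackOf threshold T
    result (inj₁ q) = q
    result (inj₂ q) = contradiction
        (trans (trans size-threshold-half (sym size-T)) (pullback-size {threshold ᶜ} {T} q))
        size-threshold≢size-thresholdᶜ

open import Data.Nat using (_*_)

theorem1p1 : (p : ℕ) (p-prime : Prime p) →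
  let open AffinePlane p {{prime⇒nonZero p-prime}} hiding (_*_)
      Extremal : Subset → Set
      Extremal S = size S ≡ p * (p ∸ 1) / 2 × Exactly (p ∸ 2) (Equidistributed S)
  in ∃ λ (S : Subset) →
       Extremal S
       × (∀ (T U : Subset) → Extremal T → Extremal U → T TransformsTo U)
       × (∀ (T : Subset) → Exactly 3 (Special T) →
            T TransformsTo S ⊎ T TransformsTo (S ᶜ))
theorem1p1 p p-prime = threshold , threshold-extremal
  , (λ T U T-extremal U-extremal → pullback⇒transforms {U} {T}
      (pullback-unique {threshold} {T} {U} (extremal⇒threshold T T-extremal)
          (extremal⇒threshold U U-extremal)))
  , λ T three → Sum.map (pullback⇒transforms {threshold} {T}) (pullback⇒transforms {threshold ᶜ} {T})
      (three-special⇒threshold T three)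
  where open Plane p p-prime
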